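{- Every Turing-recognizable (i.e. recursively enumerable) language $L$ belongs to $\mathsf{weak}\text{ - }\mathsf{qAM}_1(1)$; that is, $L$ has a weak qAM proof system with perfect completeness whose verifier uses constant space.
   Context: **Superoperators.** A superoperator on a finite-dimensional quantum register is a finite family $\mathcal{E}=\{E_1,\dots,E_k\}$ of square matrices with rational entries with $\sum_{i=1}^k E_i^\dagger E_i=I$. Applied to a register in state $|\psi\rangle$, it yields outcome $i$ with probability $p_i=\|E_i|\psi\rangle\|^2$, and then (if $p_i>0$) the new state is $E_i|\psi\rangle/\sqrt{p_i}$. As a special one-outcome operator, the register may also be (re)initialized to a predefined state. **qAM proof systems.** A qAM proof system is a pair $(P,V)$ (prover, verifier). $V$ is a Turing machine with a two-way read-only input tape (the input is delimited by end symbols), a two-way read/write work tape, a communication cell over a finite alphabet, and a quantum register of fixed dimension (independent of the input). States of $V$ are partitioned into reading, communication, accepting and rejecting states. In a reading state, a superoperator determined by the current state and the symbols under the tape heads is applied to the register; the outcome is automatically written on the communication cell (so it is revealed to the prover), and the next configuration is determined by the state, the scanned symbols and the outcome (deterministic transitions use the identity). In a communication state, $V$ writes on the cell a symbol determined by its state, the prover answers with a symbol, and $V$'s next state is determined by its state and the prover's symbol. A prover is an arbitrary (not necessarily computable) function giving its response from the input and the communication history so far. The computation may run forever. Acceptance (rejection) probability of $(P,V)$ on $x$ is the total probability of reaching an accepting (rejecting) state. $V$ is $s(n)$ space-bounded if it uses $O(s(n))$ work-tape cells on inputs of length $n$. **Class.** $L\in\mathsf{weak}\text{ - }\mathsf{qAM}_1(1)$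 iff there are $(P,V)$ with $V$ using $O(1)$ space and $\epsilon<\frac12$ such that: for all $x\in L$, $(P,V)$ accepts $x$ with probability exactly $1$ (perfect completeness); for all $x\notin L$ and all provers $P^*$, $(P^*,V)$ accepts $x$ with probability at most $\epsilon$ (weak soundness). -}

module Defs where

open import Data.Fin.Base as Fin using (Fin; zero; suc)
import Data.Fin.Properties as Fin
open import Data.List.Base using (List; []; _∷_; [_]; _++_; map; concatMap; foldr; length; lookup; tabulate)
open import Data.List.Relation.Unary.All using (All)
open import Data.Maybe.Base using (Maybe; just; nothing)
open import Data.Nat.Base as ℕ using (ℕ; zero; suc)
open import Data.Product.Base using (_×_; _,_; ∃-syntax; Σ-syntax)
open import Data.Rational.Base using (ℚ; 0ℚ; 1ℚ; ½; _+_; _-_; _*_; _≤_; _<_)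
open import Data.Rational.Properties using (+-0-commutativeMonoid)
open import Data.Sum.Base using (_⊎_; inj₁)
open import Data.Vec.Functional using (Vector)
open import Function.Bundles using (_↔_; _↣_; _⇔_; Injection)
open import Level using (Level)
open import Relation.Binary.PropositionalEquality.Core using (_≡_)
open import Relation.Nullary.Decidable.Core using (yes; no)
open import Relation.Nullary.Negation.Core using (¬_)
open import Relation.Unary using (Pred)

open import Algebra.Properties.CommutativeMonoid.Sum +-0-commutativeMonoid using (sum)

private variable
  ℓ : Level
  d : ℕ
  A B : Set

Finite : Set → Set
Finite A = ∃[ n ] (A ↔ Fin n)

Language : Set → (ℓ : Level) → Set _
Language A ℓ = Pred (List A) ℓ

data Move : Set where
  left stay right : Move

-- A two-way infinite tape with blank symbol `nothing`.  Only the cells visited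
-- so far are stored: `before` and `after` list those to the left and right of
-- the head, nearest first.
record Tape (B : Set) : Set where
  constructor tape
  field
    before : List (Maybe B)
    head   : Maybe B
    after  : List (Maybe B)

blankTape : Tape B
blankTape = tape [] nothing []

tapeOf : List B → Tape B
tapeOf []       = blankTape
tapeOf (b ∷ bs) = tape [] (just b) (map just bs)

write : Maybe B → Tape B → Tape B
write b t = record t { head = b }

move : Move → Tape B → Tape B
move left  (tape []       h rs)       = tape [] nothing (h ∷ rs)
move left  (tape (l ∷ ls) h rs)       = tape ls l (h ∷ rs)
move stay  t                          = t
move right (tape ls       h [])       = tape (h ∷ ls) nothing []
move right (tape ls       h (r ∷ rs)) = tape (h ∷ ls) r rs

cells : Tape B → ℕ
cells (tape ls _ rs) = length ls ℕ.+ suc (length rs)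

data Control (Q : Set) : Set where
  running       : Q → Control Q
  accept reject : Control Q

record TuringMachine (A : Set) : Set₁ where
  field
    State Auxiliary : Set
    state-finite    : Finite State
    aux-finite      : Finite Auxiliary

  Symbol : Set
  Symbol = A ⊎ Auxiliary

  field
    start : Control State
    δ     : State → Maybe Symbol → Control State × Maybe Symbol × Move

  Configuration : Set
  Configuration = Control State × Tape Symbol

  step : Configuration → Configuration
  step (running q , t) = let (q′ , b , m) = δ q (Tape.head t) in q′ , move m (write b t)
  step (accept    , t) = accept , t
  step (reject    , t) = reject , t

  run : ℕ → Configuration → Configuration
  run zero    c = c
  run (suc n) c = run n (step c)

  Accepts : List A → Set
  Accepts x = ∃[ n ] ∃[ t ] run n (start , tapeOf (map inj₁ x)) ≡ (accept , t)

TuringRecognizable : Language A ℓ → Set _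
TuringRecognizable {A} L = Σ[ M ∈ TuringMachine A ] (∀ x → L x ⇔ TuringMachine.Accepts M x)

Matrix : ℕ → Set
Matrix d = Fin d → Fin d → ℚ

identity : Matrix d
identity a b with a Fin.≟ b
... | yes _ = 1ℚ
... | no  _ = 0ℚ

-- The entries are rational, so this is also the conjugate transpose.
_† : Matrix d → Matrix d
(E †) a b = E b a

_·_ : Matrix d → Matrix d → Matrix d
(E · F) a b = sum λ c → E a c * F c b

_▷_ : Matrix d → Vector ℚ d → Vector ℚ d
(E ▷ v) a = sum λ b → E a b * v b

‖_‖² : Vector ℚ d → ℚ
‖ v ‖² = sum λ a → v a * v a

record Superoperator (d : ℕ) : Set where
  field
    outcomes : ℕ
    operator : Fin outcomes → Matrix d
    complete : ∀ a b → (sum λ i → ((operator i †) · operator i) a b) ≡ identity a b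

open Superoperator

data Delimited (A : Set) : Set where
  ⊢ ⊣ : Delimited A
  sym : A → Delimited A

delimit : List A → List (Delimited A)
delimit x = ⊢ ∷ map sym x ++ [ ⊣ ]

Position : List A → Set
Position x = Fin (length (delimit x))

forward : ∀ {n} → Fin n → Fin n
forward {suc zero}    zero    = zero
forward {suc (suc n)} zero    = suc zero
forward               (suc i) = suc (forward i)

-- The head stays in place when asked to leave the delimited input.
moveInput : ∀ {n} → Move → Fin n → Fin n
moveInput left  = Fin.pred
moveInput stay  = λ i → i
moveInput right = forward

-- The effect on a d-dimensional register, the symbols by which the outcomes are
-- shown on the communication cell C, and the transition T taken on each outcome.
data Operation (d : ℕ) (C T : Set) : Set where
  apply      : (𝓔 : Superoperator d) → Fin (outcomes 𝓔) ↣ C → (Fin (outcomes 𝓔) → T) → Operation d C T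
  initialize : C → T → Operation d C T

data VerifierState (R C A J : Set) : Set where
  reading       : R → VerifierState R C A J
  communicating : C → VerifierState R C A J
  accepting     : A → VerifierState R C A J
  rejecting     : J → VerifierState R C A J

record Transition (Q W : Set) : Set where
  constructor transition
  field
    next      : Q
    written   : Maybe W
    workMove  : Move
    inputMove : Move

record Verifier (A : Set) : Set₁ where
  field
    Reading Communicating Accepting Rejecting : Set
    reading-finite       : Finite Reading
    communicating-finite : Finite Communicating
    accepting-finite     : Finite Accepting
    rejecting-finite     : Finite Rejecting

    Cell Work   : Set
    cell-finite : Finite Cell
    work-finite : Finite Work

    dimension    : ℕ
    initial      : Vector ℚ dimension
    initial-unit : ‖ initial ‖² ≡ 1ℚ

  State : Set
  State = VerifierState Reading Communicating Accepting Rejecting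

  field
    start  : State
    δ      : Reading → Delimited A → Maybe Work → Operation dimension Cell (Transition State Work)
    ask    : Communicating → Cell
    answer : Communicating → Cell → State

-- A prover is given the input and everything that has appeared on the
-- communication cell, most recent symbol first.
Prover : Verifier A → Set
Prover {A} V = List A → List (Verifier.Cell V) → Verifier.Cell V

module Interaction (V : Verifier A) (P : Prover V) (x : List A) where
  open Verifier V

  -- One branch of the computation.  Normalizing the state after a measurement
  -- would need square roots, so the register is kept unnormalized since its last
  -- initialization: the state is `register` divided by its norm, and `weight` is
  -- the probability with which that initialization was reached on this branch.
  record Branch : Set where
    constructor branch
    field
      state    : State
      position : Position x
      work     : Tape Work
      history  : List Cell
      weight   : ℚ
      register : Vector ℚ dimension

  open Branch

  probability : Branch → ℚ
  probability b = weight b * ‖ register b ‖²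

  initially : Branch
  initially = branch start zero blankTape [] 1ℚ initial

  follow : Transition State Work → Cell → Branch → Branch
  follow (transition q w m m′) c b = record b
    { state    = q
    ; position = moveInput m′ (position b)
    ; work     = move m (write w (work b))
    ; history  = c ∷ history b
    }

  perform : Operation dimension Cell (Transition State Work) → Branch → List Branch
  perform (apply 𝓔 shown next) b = tabulate λ i →
    record (follow (next i) (Injection.to shown i) b) { register = operator 𝓔 i ▷ register b }
  perform (initialize shown next) b =
    [ record (follow next shown b) { weight = probability b ; register = initial } ]

  communicate : Communicating → Branch → Branch
  communicate q b = record b { state = answer q reply ; history = reply ∷ asked }
    where
    asked = ask q ∷ history b
    reply = P x asked

  stepFrom : State → Branch → List Branch
  stepFrom (reading q)       b = perform (δ q (lookup (delimit x) (position b)) (Tape.head (work b))) b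
  stepFrom (communicating q) b = [ communicate q b ]
  stepFrom (accepting _)     b = [ b ]
  stepFrom (rejecting _)     b = [ b ]

  step : Branch → List Branch
  step b = stepFrom (state b) b

  run : ℕ → Branch → List Branch
  run zero    b = [ b ]
  run (suc n) b = concatMap (run n) (step b)

  branches : ℕ → List Branch
  branches n = run n initially

  acceptedIn : State → ℚ → ℚ
  acceptedIn (accepting _) p = p
  acceptedIn _             _ = 0ℚ

  accepted : Branch → ℚ
  accepted b = acceptedIn (state b) (probability b)

  acceptedWithin : ℕ → ℚ
  acceptedWithin n = foldr _+_ 0ℚ (map accepted (branches n))

  -- The acceptance probability is the supremum of the nondecreasing sequence
  -- `acceptedWithin`; it is a real number, bounded by or equal to a rational one
  -- in the following senses.
  AcceptsWithProbabilityAtMost : ℚ → Set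
  AcceptsWithProbabilityAtMost p = ∀ n → acceptedWithin n ≤ p

  AcceptsWithProbability : ℚ → Set
  AcceptsWithProbability p =
    AcceptsWithProbabilityAtMost p × (∀ δ → 0ℚ < δ → ∃[ n ] (p - δ < acceptedWithin n))

-- Required on every input and against every prover; c is the constant of O(s).
SpaceBounded : (ℕ → ℕ) → Verifier A → Set
SpaceBounded s V = ∃[ c ] ∀ P x n →
  let open Interaction V P x in
  All (λ b → 0ℚ < probability b → cells (Branch.work b) ℕ.≤ c ℕ.* s (length x)) (branches n)

weak-qAM₁ : (ℕ → ℕ) → Pred (Language A ℓ) _
weak-qAM₁ {A} s L =
  Σ[ V ∈ Verifier A ] Σ[ P ∈ Prover V ] Σ[ ε ∈ ℚ ]
    SpaceBounded s V
  × ε < ½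
  × (∀ x → L x → Interaction.AcceptsWithProbability V P x 1ℚ)
  × (∀ x → ¬ L x → ∀ P* → Interaction.AcceptsWithProbabilityAtMost V P* x ε)

{-# OPTIONS --safe #-}
module Submission where

-- The verifier simulates the machine with its control and the scanned letter in
-- its own state, and with the two parts of the tape in the register: a vector
-- proportional to (1, L, R, Y), where L and R are the parts of the tape to the
-- left and to the right of the head, read as numbers in base b.  Pushing a letter
-- is the linear map L ↦ b L + c.  Popping a letter is not linear: the prover counts
-- Y up by ticks and then announces a letter of code c, claiming that R = b Y + c,
-- and the verifier measures the component 2 (R - b Y - c).  For a true claim this
-- never leads to rejection; for a false one it rejects with at least four times
-- the square of the first component.  Any linear map can be performed up to a
-- factor with some probability, and if this fails the verifier starts anew.  When
-- the machine accepts, the verifier accepts with the square of the first component.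
-- Since this only decreases, a prover who has ever lied gains at most a quarter of
-- the probability with which the lie has led to rejection; an honest one is never
-- rejected and succeeds almost surely within finitely many restarts.
open import Defs
open import Algebra.Bundles using (CommutativeRing)
open import Data.Fin.Base as Fin using (Fin; zero; suc; toℕ; inject≤)
open import Data.Fin.Patterns
import Data.Fin.Properties as Fin
import Data.Integer.Base as ℤ
import Data.Integer.Properties as ℤ
open import Data.List.Base
  using (List; []; _∷_; [_]; _++_; _∷ʳ_; map; concatMap; foldr; length; lookup; tabulate; initLast; _∷ʳ′_)
open import Data.List.Properties using (length-++; map-++; ++-assoc; ++-identityʳ; length-map)
open import Data.List.Relation.Unary.All as All using (All; []; _∷_)
import Data.List.Relation.Unary.All.Properties as All
open import Data.Maybe.Base using (Maybe; just; nothing)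
open import Data.Nat.Base as ℕ using (ℕ; zero; suc; z≤n; s≤s)
import Data.Nat.Coprimality as Coprimality
import Data.Nat.DivMod as ℕ
import Data.Nat.Properties as ℕ
open import Data.Product.Base using (_×_; _,_; ∃-syntax; proj₁; proj₂)
open import Data.Product.Function.NonDependent.Propositional using (_×-↔_)
open import Data.Rational.Base
  using (ℚ; mkℚ; 0ℚ; 1ℚ; ½; _+_; _-_; _*_; -_; 1/_; _/_; _≤_; _<_; *<*; positive; nonNegative; nonPositive; >-nonZero)
open import Data.Rational.Properties
open import Data.Rational.Solver using (module +-*-Solver)
open import Data.Sum.Base using (_⊎_; inj₁; inj₂)
open import Data.Sum.Function.Propositional using (_⊎-↔_)
open import Data.Sum.Properties using (inj₁-injective)
open import Data.Vec.Functional using (Vector)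
open import Function.Base using (_∘_)
open import Function.Bundles using (_↣_; _↔_; Injection; Inverse; Equivalence; mk↔ₛ′; mk↣)
open import Function.Construct.Composition using (_↔-∘_)
open import Function.Construct.Identity using (↔-id)
open import Function.Construct.Symmetry using (↔-sym)
open import Function.Properties.Inverse using (↔⇒↣)
open import Level using (Level)
open import Relation.Binary.Definitions using (tri<; tri≈; tri>)
open import Relation.Binary.PropositionalEquality as ≡
  using (_≡_; _≢_; _≗_; refl; trans; cong; cong₂; subst; module ≡-Reasoning)
open import Relation.Nullary.Decidable using (dec⇒maybe; toWitness; yes; no)
open import Relation.Nullary.Negation using (contradiction; ¬_)
open import Relation.Unary using (_∈_)
open import Tactic.RingSolver using (solve-∀)
open import Tactic.RingSolver.Core.AlmostCommutativeRing using (AlmostCommutativeRing; fromCommutativeRing)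

open import Algebra.Properties.Semiring.Sum (CommutativeRing.semiring +-*-commutativeRing)
  using (sum; sum-cong-≗; ∑-comm; *-distribˡ-sum; *-distribʳ-sum)

private variable
  d n : ℕ
  p q r s : ℚ
  A B : Set

-- The obstacle is that gates succeed only up to a factor: the weight of the branch in which nothing
-- fails decays with the length of the simulation, so neither the chance to catch a lie nor the
-- chance to finish has a useful lower bound. What survives is a ratio. Rejection after a lie and
-- later acceptance are read off two components of one unnormalized vector, which share every
-- factor. The error of a false claim is a nonzero integer, hence at least 1 in absolute value;
-- doubling it makes the ratio of the squares 4, and the bound ¼ is its inverse. Soundness is a
-- supermartingale argument: a branch is worth a quarter of its probability, plus its squared first
-- component once a lie has gone undetected. Completeness bounds the expected time. If an attempt
-- succeeds with weight α, lasts γ on average, and costs at most N steps to prepare, the bound H is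
-- given by the renewal equation H = N + γ + (1 - α) H, that is α H = N + γ. A Markov inequality
-- then bounds n times the weight not yet accepted after n steps by H, so that convergence to 1 is
-- obtained with rational numbers only.

ℚ-ring : AlmostCommutativeRing _ _
ℚ-ring = fromCommutativeRing +-*-commutativeRing (λ x → dec⇒maybe (0ℚ ≟ x))

-- Order on the rational numbers

0≤-diff : p ≤ q → 0ℚ ≤ q - p
0≤-diff {p} {q} p≤q = subst (_≤ q - p) (+-inverseʳ p) (+-monoˡ-≤ (- p) p≤q)

≤-from-diff : 0ℚ ≤ r → p + r ≡ q → p ≤ q
≤-from-diff {r} {p} 0≤r refl = subst (_≤ p + r) (+-identityʳ p) (+-monoʳ-≤ p 0≤r)

0≤-+ : 0ℚ ≤ p → 0ℚ ≤ q → 0ℚ ≤ p + q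
0≤-+ = +-mono-≤

0≤-* : 0ℚ ≤ p → 0ℚ ≤ q → 0ℚ ≤ p * q
0≤-* {p} {q} 0≤p 0≤q =
  nonNegative⁻¹ (p * q) {{nonNeg*nonNeg⇒nonNeg p {{nonNegative 0≤p}} q {{nonNegative 0≤q}}}}

0<-* : 0ℚ < p → 0ℚ < q → 0ℚ < p * q
0<-* {p} {q} 0<p 0<q = positive⁻¹ (p * q) {{pos*pos⇒pos p {{positive 0<p}} q {{positive 0<q}}}}

0≤-square : ∀ p → 0ℚ ≤ p * p
0≤-square p with ≤-total 0ℚ p
... | inj₁ 0≤p = 0≤-* 0≤p 0≤p
... | inj₂ p≤0 = nonNegative⁻¹ (p * p)
  {{nonPos*nonPos⇒nonPos p {{nonPositive p≤0}} p {{nonPositive p≤0}}}}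

0≤1 : 0ℚ ≤ 1ℚ
0≤1 = toWitness {a? = 0ℚ ≤? 1ℚ} _

0<1 : 0ℚ < 1ℚ
0<1 = toWitness {a? = 0ℚ <? 1ℚ} _

0≤-sum : {f : Vector ℚ n} → (∀ i → 0ℚ ≤ f i) → 0ℚ ≤ sum f
0≤-sum {n = zero}  0≤f = ≤-refl
0≤-sum {n = suc n} 0≤f = 0≤-+ (0≤f zero) (0≤-sum (0≤f ∘ suc))

0≤-‖‖² : (v : Vector ℚ n) → 0ℚ ≤ ‖ v ‖²
0≤-‖‖² v = 0≤-sum (λ i → 0≤-square (v i))

-- Rational registers

‖‖²-cong : {v w : Vector ℚ n} → v ≗ w → ‖ v ‖² ≡ ‖ w ‖²
‖‖²-cong v≗w = sum-cong-≗ λ i → cong₂ _*_ (v≗w i) (v≗w i)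

▷-cong : (E : Matrix d) {v w : Vector ℚ d} → v ≗ w → E ▷ v ≗ E ▷ w
▷-cong E v≗w a = sum-cong-≗ λ b → cong (E a b *_) (v≗w b)

identity-suc : (a b : Fin d) → identity (suc a) (suc b) ≡ identity a b
identity-suc a b with a Fin.≟ b
... | yes _ = refl
... | no  _ = refl

identity-sym : (a b : Fin d) → identity a b ≡ identity b a
identity-sym zero    zero    = refl
identity-sym zero    (suc b) = refl
identity-sym (suc a) zero    = refl
identity-sym (suc a) (suc b) = begin
  identity (suc a) (suc b) ≡⟨ identity-suc a b ⟩
  identity a b             ≡⟨ identity-sym a b ⟩
  identity b a             ≡⟨ identity-suc b a ⟨
  identity (suc b) (suc a) ∎
  where open ≡-Reasoning

sum-zero : {f : Vector ℚ n} → (∀ i → f i ≡ 0ℚ) → sum f ≡ 0ℚ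
sum-zero {n = zero}  f≡0 = refl
sum-zero {n = suc n} f≡0 = cong₂ _+_ (f≡0 zero) (sum-zero (f≡0 ∘ suc))

sum-identity : (v : Vector ℚ d) (a : Fin d) → (sum λ b → v b * identity a b) ≡ v a
sum-identity {suc d} v zero = begin
  v zero * 1ℚ + (sum λ b → v (suc b) * 0ℚ)
    ≡⟨ cong₂ _+_ (*-identityʳ (v zero)) (sum-zero λ b → *-zeroʳ (v (suc b))) ⟩
  v zero + 0ℚ
    ≡⟨ +-identityʳ (v zero) ⟩
  v zero ∎
  where open ≡-Reasoning
sum-identity {suc d} v (suc a) = begin
  v zero * 0ℚ + (sum λ b → v (suc b) * identity (suc a) (suc b))
    ≡⟨ cong₂ _+_ (*-zeroʳ (v zero)) (sum-cong-≗ λ b → cong (v (suc b) *_) (identity-suc a b)) ⟩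
  0ℚ + (sum λ b → v (suc b) * identity a b)
    ≡⟨ +-identityˡ _ ⟩
  (sum λ b → v (suc b) * identity a b)
    ≡⟨ sum-identity (v ∘ suc) a ⟩
  v (suc a) ∎
  where open ≡-Reasoning

sum-*-sum : (f : Vector ℚ d) (g : Vector ℚ n) → sum f * sum g ≡ sum λ a → sum λ b → f a * g b
sum-*-sum f g = trans (*-distribʳ-sum (sum g) f) (sum-cong-≗ λ a → *-distribˡ-sum (f a) g)

-- The squared norm becomes the quadratic form of the Gram matrix `(E †) · E`, the only thing that
-- the completeness relation of a superoperator speaks about.
‖▷‖² : (E : Matrix d) (v : Vector ℚ d) →
       ‖ E ▷ v ‖² ≡ sum λ a → sum λ b → (v a * v b) * ((E †) · E) a b
‖▷‖² E v = begin
  ‖ E ▷ v ‖²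
    ≡⟨ sum-cong-≗ (λ c → sum-*-sum (λ a → E c a * v a) (λ b → E c b * v b)) ⟩
  (sum λ c → sum λ a → sum λ b → (E c a * v a) * (E c b * v b))
    ≡⟨ ∑-comm (λ c a → sum λ b → (E c a * v a) * (E c b * v b)) ⟩
  (sum λ a → sum λ c → sum λ b → (E c a * v a) * (E c b * v b))
    ≡⟨ sum-cong-≗ (λ a → ∑-comm (λ c b → (E c a * v a) * (E c b * v b))) ⟩
  (sum λ a → sum λ b → sum λ c → (E c a * v a) * (E c b * v b))
    ≡⟨ sum-cong-≗ (λ a → sum-cong-≗ λ b → trans
         (sum-cong-≗ λ c → rearrange (E c a) (v a) (E c b) (v b))
         (≡.sym (*-distribˡ-sum (v a * v b) (λ c → E c a * E c b)))) ⟩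
  (sum λ a → sum λ b → (v a * v b) * ((E †) · E) a b) ∎
  where
  open ≡-Reasoning
  rearrange : ∀ e x f y → (e * x) * (f * y) ≡ (x * y) * (e * f)
  rearrange = solve-∀ ℚ-ring

module _ (𝓔 : Superoperator d) where
  open Superoperator 𝓔

  total-probability : ∀ v → (sum λ i → ‖ operator i ▷ v ‖²) ≡ ‖ v ‖²
  total-probability v = begin
    (sum λ i → ‖ operator i ▷ v ‖²)
      ≡⟨ sum-cong-≗ (λ i → ‖▷‖² (operator i) v) ⟩
    (sum λ i → sum λ a → sum λ b → (v a * v b) * G i a b)
      ≡⟨ ∑-comm (λ i a → sum λ b → (v a * v b) * G i a b) ⟩
    (sum λ a → sum λ i → sum λ b → (v a * v b) * G i a b)
      ≡⟨ sum-cong-≗ (λ a → ∑-comm (λ i b → (v a * v b) * G i a b)) ⟩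
    (sum λ a → sum λ b → sum λ i → (v a * v b) * G i a b)
      ≡⟨ sum-cong-≗ (λ a → sum-cong-≗ λ b → begin
           (sum λ i → (v a * v b) * G i a b) ≡⟨ *-distribˡ-sum (v a * v b) (λ i → G i a b) ⟨
           (v a * v b) * (sum λ i → G i a b) ≡⟨ cong ((v a * v b) *_) (complete a b) ⟩
           (v a * v b) * identity a b ∎) ⟩
    (sum λ a → sum λ b → (v a * v b) * identity a b)
      ≡⟨ sum-cong-≗ (λ a → sum-identity (λ b → v a * v b) a) ⟩
    ‖ v ‖² ∎
    where
    open ≡-Reasoning
    G : Fin outcomes → Matrix d
    G i = (operator i †) · operator i

-- The rows of the matrix of a quaternion under multiplication: the given one,
-- and three more of the same length orthogonal to it and to each other.
quaternion : {X : Set} → (X → X) → (Fin 4 → X) → Fin 4 → Fin 4 → X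
quaternion neg m 0F a  = m a
quaternion neg m 1F 0F = neg (m 1F)
quaternion neg m 1F 1F = m 0F
quaternion neg m 1F 2F = neg (m 3F)
quaternion neg m 1F 3F = m 2F
quaternion neg m 2F 0F = neg (m 2F)
quaternion neg m 2F 1F = m 3F
quaternion neg m 2F 2F = m 0F
quaternion neg m 2F 3F = neg (m 1F)
quaternion neg m 3F 0F = neg (m 3F)
quaternion neg m 3F 1F = neg (m 2F)
quaternion neg m 3F 2F = m 1F
quaternion neg m 3F 3F = m 0F

companion : Fin 4 → Vector ℚ 4 → Vector ℚ 4
companion t m = quaternion -_ m t

-- A quaternion acts by a multiple of an orthogonal matrix, so its columns are orthogonal as well as
-- its rows; the columns are what a sum of Gram matrices involves. The table `quaternion` is generic
-- in its entries so that it can also be read over polynomials, which reduces each entry to a ring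
-- identity.
companion-orthogonal : ∀ m a b → (sum λ t → companion t m a * companion t m b) ≡ ‖ m ‖² * identity a b
companion-orthogonal m = λ where
    0F 0F → solve 4 (equation 0F 0F) refl (m 0F) (m 1F) (m 2F) (m 3F)
    0F 1F → solve 4 (equation 0F 1F) refl (m 0F) (m 1F) (m 2F) (m 3F)
    0F 2F → solve 4 (equation 0F 2F) refl (m 0F) (m 1F) (m 2F) (m 3F)
    0F 3F → solve 4 (equation 0F 3F) refl (m 0F) (m 1F) (m 2F) (m 3F)
    1F 0F → solve 4 (equation 1F 0F) refl (m 0F) (m 1F) (m 2F) (m 3F)
    1F 1F → solve 4 (equation 1F 1F) refl (m 0F) (m 1F) (m 2F) (m 3F)
    1F 2F → solve 4 (equation 1F 2F) refl (m 0F) (m 1F) (m 2F) (m 3F)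
    1F 3F → solve 4 (equation 1F 3F) refl (m 0F) (m 1F) (m 2F) (m 3F)
    2F 0F → solve 4 (equation 2F 0F) refl (m 0F) (m 1F) (m 2F) (m 3F)
    2F 1F → solve 4 (equation 2F 1F) refl (m 0F) (m 1F) (m 2F) (m 3F)
    2F 2F → solve 4 (equation 2F 2F) refl (m 0F) (m 1F) (m 2F) (m 3F)
    2F 3F → solve 4 (equation 2F 3F) refl (m 0F) (m 1F) (m 2F) (m 3F)
    3F 0F → solve 4 (equation 3F 0F) refl (m 0F) (m 1F) (m 2F) (m 3F)
    3F 1F → solve 4 (equation 3F 1F) refl (m 0F) (m 1F) (m 2F) (m 3F)
    3F 2F → solve 4 (equation 3F 2F) refl (m 0F) (m 1F) (m 2F) (m 3F)
    3F 3F → solve 4 (equation 3F 3F) refl (m 0F) (m 1F) (m 2F) (m 3F)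
  where
  open +-*-Solver
  equation : Fin 4 → Fin 4 → (p q r s : Polynomial 4) → Polynomial 4 × Polynomial 4
  equation a b p q r s =
      term 0F :+ (term 1F :+ (term 2F :+ (term 3F :+ con 0ℚ)))
    := (p :* p :+ (q :* q :+ (r :* r :+ (s :* s :+ con 0ℚ)))) :* con (identity a b)
    where
    row : Fin 4 → Polynomial 4
    row = λ { 0F → p ; 1F → q ; 2F → r ; 3F → s }
    term : Fin 4 → Polynomial 4
    term t = quaternion :-_ row t a :* quaternion :-_ row t b

-- Superoperators on a four-dimensional register

⟨_,_,_,_⟩ : ℚ → ℚ → ℚ → ℚ → Vector ℚ 4
⟨ p , q , r , s ⟩ 0F = p
⟨ p , q , r , s ⟩ 1F = q
⟨ p , q , r , s ⟩ 2F = r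
⟨ p , q , r , s ⟩ 3F = s

-- A multiple of an arbitrary matrix M is an outcome of a superoperator.  The
-- companions of the rows of M bring the sum up to a multiple F of the identity,
-- where F is the squared Frobenius norm; since F + ((F - 1) / 2)² = ((F + 1) / 2)²,
-- one more multiple of the identity makes it a rational square.
module Gate (M : Matrix 4) where

  size : ℚ
  size = sum λ c → ‖ M c ‖²

  0≤size : 0ℚ ≤ size
  0≤size = 0≤-sum λ c → 0≤-‖‖² (M c)

  0<1+size : 0ℚ < 1ℚ + size
  0<1+size = +-mono-<-≤ 0<1 0≤size

  abstract
    unit : ℚ
    unit = (1/ (1ℚ + size)) {{>-nonZero 0<1+size}}

    0<unit : 0ℚ < unit
    0<unit = positive⁻¹ unit {{1/pos⇒pos (1ℚ + size) {{positive 0<1+size}}}}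

    unit-inverse : unit * (1ℚ + size) ≡ 1ℚ
    unit-inverse = *-inverseˡ (1ℚ + size) {{>-nonZero 0<1+size}}

  scale rest : ℚ
  scale = unit + unit
  rest  = unit * (size - 1ℚ)

  0<scale : 0ℚ < scale
  0<scale = +-mono-< 0<unit 0<unit

  completion : rest * rest + scale * scale * size ≡ 1ℚ
  completion = begin
    rest * rest + scale * scale * size          ≡⟨ expand unit size ⟩
    (unit * (1ℚ + size)) * (unit * (1ℚ + size)) ≡⟨ cong (λ x → x * x) unit-inverse ⟩
    1ℚ                                          ∎
    where
    open ≡-Reasoning
    expand : ∀ u f → (u * (f - 1ℚ)) * (u * (f - 1ℚ)) + (u + u) * (u + u) * f
                   ≡ (u * (1ℚ + f)) * (u * (1ℚ + f))
    expand = solve-∀ ℚ-ring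

  operator : Fin 5 → Matrix 4
  operator zero    c a = rest * identity c a
  operator (suc t) c a = scale * companion t (M c) a

  rest-part : ∀ a b → ((operator zero †) · operator zero) a b ≡ rest * rest * identity a b
  rest-part a b = begin
    (sum λ c → (rest * identity c a) * (rest * identity c b))
      ≡⟨ sum-cong-≗ (λ c → trans (regroup rest (identity c a) (identity c b))
           (cong (rest * rest * identity c a *_) (identity-sym c b))) ⟩
    (sum λ c → (rest * rest * identity c a) * identity b c)
      ≡⟨ sum-identity (λ c → rest * rest * identity c a) b ⟩
    rest * rest * identity b a
      ≡⟨ cong (rest * rest *_) (identity-sym b a) ⟩
    rest * rest * identity a b ∎
    where
    open ≡-Reasoning
    regroup : ∀ k x y → (k * x) * (k * y) ≡ (k * k * x) * y
    regroup = solve-∀ ℚ-ring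

  companion-part : ∀ a b → (sum λ t → ((operator (suc t) †) · operator (suc t)) a b)
                         ≡ scale * scale * size * identity a b
  companion-part a b = begin
    (sum λ t → sum λ c → (scale * companion t (M c) a) * (scale * companion t (M c) b))
      ≡⟨ ∑-comm (λ t c → (scale * companion t (M c) a) * (scale * companion t (M c) b)) ⟩
    (sum λ c → sum λ t → (scale * companion t (M c) a) * (scale * companion t (M c) b))
      ≡⟨ sum-cong-≗ (λ c → sum-cong-≗ λ t → regroup scale (companion t (M c) a) (companion t (M c) b)) ⟩
    (sum λ c → sum λ t → (scale * scale) * (companion t (M c) a * companion t (M c) b))
      ≡⟨ sum-cong-≗ (λ c → *-distribˡ-sum (scale * scale) (λ t → companion t (M c) a * companion t (M c) b)) ⟨
    (sum λ c → (scale * scale) * (sum λ t → companion t (M c) a * companion t (M c) b))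
      ≡⟨ sum-cong-≗ (λ c → trans (cong (scale * scale *_) (companion-orthogonal (M c) a b))
           (rotate (scale * scale) ‖ M c ‖² (identity a b))) ⟩
    (sum λ c → (scale * scale * identity a b) * ‖ M c ‖²)
      ≡⟨ *-distribˡ-sum (scale * scale * identity a b) (λ c → ‖ M c ‖²) ⟨
    (scale * scale * identity a b) * size
      ≡⟨ swap (scale * scale) (identity a b) size ⟩
    scale * scale * size * identity a b ∎
    where
    open ≡-Reasoning
    regroup : ∀ k x y → (k * x) * (k * y) ≡ (k * k) * (x * y)
    regroup = solve-∀ ℚ-ring
    rotate : ∀ k x y → k * (x * y) ≡ (k * y) * x
    rotate = solve-∀ ℚ-ring
    swap : ∀ k x y → (k * x) * y ≡ (k * y) * x
    swap = solve-∀ ℚ-ring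

  superoperator : Superoperator 4
  superoperator = record
    { outcomes = 5
    ; operator = operator
    ; complete = λ a b → begin
        ((operator zero †) · operator zero) a b + (sum λ t → ((operator (suc t) †) · operator (suc t)) a b)
          ≡⟨ cong₂ _+_ (rest-part a b) (companion-part a b) ⟩
        rest * rest * identity a b + scale * scale * size * identity a b
          ≡⟨ *-distribʳ-+ (identity a b) (rest * rest) (scale * scale * size) ⟨
        (rest * rest + scale * scale * size) * identity a b
          ≡⟨ cong (_* identity a b) completion ⟩
        1ℚ * identity a b
          ≡⟨ *-identityˡ (identity a b) ⟩
        identity a b ∎
    }
    where open ≡-Reasoning

  -- The companion with index 0 is the row itself, so outcome 1 is the desired multiple of `M`; the
  -- remaining outcomes only serve completeness.
  main-outcome : ∀ v → operator 1F ▷ v ≗ λ a → scale * (M ▷ v) a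
  main-outcome v a = trans
    (sum-cong-≗ λ b → *-assoc scale (M a b) (v b))
    (≡.sym (*-distribˡ-sum scale (λ b → M a b * v b)))

  -- With F for `size`, the scale is 2 / (1 + F), which is at most 1 once F is at least 1. For
  -- matrices with first row `unitRow` this means that the first component never grows.
  scale²≤1 : 1ℚ ≤ size → scale * scale ≤ 1ℚ
  scale²≤1 1≤size = ≤-from-diff
    (0≤-+ (0≤-square rest) (0≤-* (0≤-square scale) (0≤-diff 1≤size)))
    (trans (regroup (scale * scale) (rest * rest) size) completion)
    where
    regroup : ∀ k r f → k + (r + k * (f - 1ℚ)) ≡ r + k * f
    regroup = solve-∀ ℚ-ring

-- On outcome 0 the component with index 1 has vanished, the two after it are
-- moved down, and the last one is cleared.
dropping : Superoperator 4
dropping = record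
  { outcomes = 2
  ; operator = operator
  ; complete = toWitness {a? = Fin.all? λ a → Fin.all? λ b → _ ≟ _} _
  }
  where
  operator : Fin 2 → Matrix 4
  operator 0F 0F = identity 0F
  operator 0F 1F = identity 2F
  operator 0F 2F = identity 3F
  operator 0F 3F = λ _ → 0ℚ
  operator 1F 0F = identity 1F
  operator 1F _  = λ _ → 0ℚ

measuring : Superoperator 4
measuring = record
  { outcomes = 2
  ; operator = operator
  ; complete = toWitness {a? = Fin.all? λ a → Fin.all? λ b → _ ≟ _} _
  }
  where
  operator : Fin 2 → Matrix 4
  operator 0F 0F      = identity 0F
  operator 0F (suc _) = λ _ → 0ℚ
  operator 1F 0F      = λ _ → 0ℚ
  operator 1F (suc a) = identity (suc a)

▷-identity-row : (E : Matrix d) (a b : Fin d) (v : Vector ℚ d) → E a ≗ identity b → (E ▷ v) a ≡ v b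
▷-identity-row E a b v Ea≗ = trans
  (sum-cong-≗ λ c → trans (cong (_* v c) (Ea≗ c)) (*-comm (identity b c) (v c)))
  (sum-identity v b)

▷-zero-row : (E : Matrix d) (a : Fin d) (v : Vector ℚ d) → (∀ b → E a b ≡ 0ℚ) → (E ▷ v) a ≡ 0ℚ
▷-zero-row E a v Ea≡0 = sum-zero λ b → trans (cong (_* v b) (Ea≡0 b)) (*-zeroˡ (v b))

open Superoperator using () renaming (operator to kraus)

dropping-0 : ∀ v → kraus dropping 0F ▷ v ≗ ⟨ v 0F , v 2F , v 3F , 0ℚ ⟩
dropping-0 v 0F = ▷-identity-row (kraus dropping 0F) 0F 0F v λ _ → refl
dropping-0 v 1F = ▷-identity-row (kraus dropping 0F) 1F 2F v λ _ → refl
dropping-0 v 2F = ▷-identity-row (kraus dropping 0F) 2F 3F v λ _ → refl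
dropping-0 v 3F = ▷-zero-row (kraus dropping 0F) 3F v λ _ → refl

dropping-1 : ∀ v → kraus dropping 1F ▷ v ≗ ⟨ v 1F , 0ℚ , 0ℚ , 0ℚ ⟩
dropping-1 v 0F = ▷-identity-row (kraus dropping 1F) 0F 1F v λ _ → refl
dropping-1 v 1F = ▷-zero-row (kraus dropping 1F) 1F v λ _ → refl
dropping-1 v 2F = ▷-zero-row (kraus dropping 1F) 2F v λ _ → refl
dropping-1 v 3F = ▷-zero-row (kraus dropping 1F) 3F v λ _ → refl

measuring-0 : ∀ v → kraus measuring 0F ▷ v ≗ ⟨ v 0F , 0ℚ , 0ℚ , 0ℚ ⟩
measuring-0 v 0F = ▷-identity-row (kraus measuring 0F) 0F 0F v λ _ → refl
measuring-0 v 1F = ▷-zero-row (kraus measuring 0F) 1F v λ _ → refl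
measuring-0 v 2F = ▷-zero-row (kraus measuring 0F) 2F v λ _ → refl
measuring-0 v 3F = ▷-zero-row (kraus measuring 0F) 3F v λ _ → refl

-- Acceptance probabilities of an arbitrary verifier

fromℕ : ℕ → ℚ
fromℕ zero    = 0ℚ
fromℕ (suc n) = 1ℚ + fromℕ n

0≤fromℕ : ∀ n → 0ℚ ≤ fromℕ n
0≤fromℕ zero    = ≤-refl
0≤fromℕ (suc n) = 0≤-+ 0≤1 (0≤fromℕ n)

total : (B → ℚ) → List B → ℚ
total f bs = foldr _+_ 0ℚ (map f bs)

total-++ : (f : B → ℚ) (bs cs : List B) → total f (bs ++ cs) ≡ total f bs + total f cs
total-++ f []       cs = ≡.sym (+-identityˡ _)
total-++ f (b ∷ bs) cs = trans (cong (f b +_) (total-++ f bs cs)) (≡.sym (+-assoc (f b) _ _))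

total-concatMap : (f : B → ℚ) (g : A → List B) (as : List A) →
                  total f (concatMap g as) ≡ total (total f ∘ g) as
total-concatMap f g []       = refl
total-concatMap f g (a ∷ as) =
  trans (total-++ f (g a) (concatMap g as)) (cong (total f (g a) +_) (total-concatMap f g as))

total-tabulate : (f : B → ℚ) (g : Fin n → B) → total f (tabulate g) ≡ sum (f ∘ g)
total-tabulate {n = zero}  f g = refl
total-tabulate {n = suc n} f g = cong (f (g zero) +_) (total-tabulate f (g ∘ suc))

0≤-total : {f : B → ℚ} {bs : List B} → All (λ b → 0ℚ ≤ f b) bs → 0ℚ ≤ total f bs
0≤-total []             = ≤-refl
0≤-total (0≤fb ∷ 0≤fbs) = 0≤-+ 0≤fb (0≤-total 0≤fbs)

module Dynamics {A : Set} (V : Verifier A) (P : Prover V) (x : List A) where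
  open Verifier V
  open Interaction V P x
  open Branch

  run-All : {Q : Branch → Set} → (∀ b → Q b → All Q (step b)) → ∀ n b → Q b → All Q (run n b)
  run-All Q-step zero    b Qb = Qb ∷ []
  run-All Q-step (suc n) b Qb =
    All.concat⁺ (All.map⁺ (All.map (λ {b′} → run-All Q-step n b′) (Q-step b Qb)))

  observe : (𝓔 : Superoperator dimension) → Fin (Superoperator.outcomes 𝓔) ↣ Cell →
            (Fin (Superoperator.outcomes 𝓔) → Transition State Work) →
            Branch → Fin (Superoperator.outcomes 𝓔) → Branch
  observe 𝓔 shown next b i =
    record (follow (next i) (Injection.to shown i) b) { register = Superoperator.operator 𝓔 i ▷ register b }

  operation : Reading → Branch → Operation dimension Cell (Transition State Work)
  operation q b = δ q (lookup (delimit x) (position b)) (Tape.head (work b))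

  perform-conserved : ∀ op b → total probability (perform op b) ≡ probability b
  perform-conserved (apply 𝓔 shown next) b = begin
    total probability (perform (apply 𝓔 shown next) b)
      ≡⟨ total-tabulate probability (observe 𝓔 shown next b) ⟩
    (sum λ i → weight b * ‖ Superoperator.operator 𝓔 i ▷ register b ‖²)
      ≡⟨ *-distribˡ-sum (weight b) (λ i → ‖ Superoperator.operator 𝓔 i ▷ register b ‖²) ⟨
    weight b * (sum λ i → ‖ Superoperator.operator 𝓔 i ▷ register b ‖²)
      ≡⟨ cong (weight b *_) (total-probability 𝓔 (register b)) ⟩
    probability b ∎
    where open ≡-Reasoning
  perform-conserved (initialize shown next) b = begin
    probability b * ‖ initial ‖² + 0ℚ ≡⟨ +-identityʳ _ ⟩
    probability b * ‖ initial ‖²      ≡⟨ cong (probability b *_) initial-unit ⟩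
    probability b * 1ℚ                ≡⟨ *-identityʳ _ ⟩
    probability b                     ∎
    where open ≡-Reasoning

  probability-conserved : ∀ b → total probability (step b) ≡ probability b
  probability-conserved b = lemma (state b)
    where
    lemma : ∀ q → total probability (stepFrom q b) ≡ probability b
    lemma (reading q)       = perform-conserved (operation q b) b
    lemma (communicating q) = +-identityʳ _
    lemma (accepting q)     = +-identityʳ _
    lemma (rejecting q)     = +-identityʳ _

  0≤-probability : ∀ b → 0ℚ ≤ weight b → 0ℚ ≤ probability b
  0≤-probability b 0≤w = 0≤-* 0≤w (0≤-‖‖² (register b))

  weight-step : ∀ b → 0ℚ ≤ weight b → All (λ b′ → 0ℚ ≤ weight b′) (step b)
  weight-step b 0≤w = stepFrom-weight (state b)
    where
    perform-weight : ∀ op → All (λ b′ → 0ℚ ≤ weight b′) (perform op b)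
    perform-weight (apply 𝓔 shown next)    = All.tabulate⁺ λ _ → 0≤w
    perform-weight (initialize shown next) = 0≤-probability b 0≤w ∷ []
    stepFrom-weight : ∀ q → All (λ b′ → 0ℚ ≤ weight b′) (stepFrom q b)
    stepFrom-weight (reading q)       = perform-weight (operation q b)
    stepFrom-weight (communicating q) = 0≤w ∷ []
    stepFrom-weight (accepting q)     = 0≤w ∷ []
    stepFrom-weight (rejecting q)     = 0≤w ∷ []

  gain : ℕ → Branch → ℚ
  gain n b = total accepted (run n b)

  gain-suc : ∀ n b → gain (suc n) b ≡ total (gain n) (step b)
  gain-suc n b = total-concatMap accepted (run n) (step b)

  0≤-accepted : ∀ b → 0ℚ ≤ weight b → 0ℚ ≤ accepted b
  0≤-accepted b 0≤w = lemma (state b)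
    where
    lemma : ∀ q → 0ℚ ≤ acceptedIn q (probability b)
    lemma (reading _)       = ≤-refl
    lemma (communicating _) = ≤-refl
    lemma (accepting _)     = 0≤-probability b 0≤w
    lemma (rejecting _)     = ≤-refl

  accepted≤probability : ∀ b → 0ℚ ≤ weight b → accepted b ≤ probability b
  accepted≤probability b 0≤w = lemma (state b)
    where
    lemma : ∀ q → acceptedIn q (probability b) ≤ probability b
    lemma (reading _)       = 0≤-probability b 0≤w
    lemma (communicating _) = 0≤-probability b 0≤w
    lemma (accepting _)     = ≤-refl
    lemma (rejecting _)     = 0≤-probability b 0≤w

  0≤-gain : ∀ n b → 0ℚ ≤ weight b → 0ℚ ≤ gain n b
  0≤-gain n b 0≤w = 0≤-total (All.map (λ {b′} → 0≤-accepted b′) (run-All weight-step n b 0≤w))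

  gain-accepting : ∀ n b {a} → state b ≡ accepting a → gain n b ≡ probability b
  gain-accepting zero b q≡ =
    trans (+-identityʳ _) (cong (λ q → acceptedIn q (probability b)) q≡)
  gain-accepting (suc n) b q≡ = begin
    gain (suc n) b                         ≡⟨ gain-suc n b ⟩
    total (gain n) (stepFrom (state b) b)  ≡⟨ cong (λ q → total (gain n) (stepFrom q b)) q≡ ⟩
    gain n b + 0ℚ                          ≡⟨ +-identityʳ _ ⟩
    gain n b                               ≡⟨ gain-accepting n b q≡ ⟩
    probability b                          ∎
    where open ≡-Reasoning

  -- Values are attached by a relation, not a function: which value is right depends on the
  -- invariant known for a branch, which its data alone do not reveal. The index is nested as in
  -- `total`.
  data Split (I : Branch → ℚ → Set) : List Branch → ℚ → Set where
    []  : Split I [] 0ℚ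
    _∷_ : ∀ {b bs φ ψ} → I b φ → Split I bs ψ → Split I (b ∷ bs) (φ + ψ)

  module Supermartingale (I : Branch → ℚ → Set)
    (dominates : ∀ {b φ} → I b φ → accepted b ≤ φ)
    (descends  : ∀ {b φ} → I b φ → ∃[ ψ ] (Split I (step b) ψ × ψ ≤ φ))
    where

    gain≤ : ∀ n {b φ} → I b φ → gain n b ≤ φ
    total-gain≤ : ∀ n {bs ψ} → Split I bs ψ → total (gain n) bs ≤ ψ

    gain≤ zero    {b} i = ≤-trans (≤-reflexive (+-identityʳ _)) (dominates i)
    gain≤ (suc n) {b} i with descends i
    ... | ψ , split , ψ≤φ =
      ≤-trans (≤-reflexive (gain-suc n b)) (≤-trans (total-gain≤ n split) ψ≤φ)

    total-gain≤ n []          = ≤-refl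
    total-gain≤ n (i ∷ split) = +-mono-≤ (gain≤ n i) (total-gain≤ n split)

  -- Probability itself is a supermartingale, by conservation.
  gain≤probability : ∀ n b → 0ℚ ≤ weight b → gain n b ≤ probability b
  gain≤probability n b 0≤w =
    Supermartingale.gain≤ I (λ {b} → dominates {b}) (λ {b} → descends {b}) n {b} (0≤w , refl)
    where
    I : Branch → ℚ → Set
    I b φ = 0ℚ ≤ weight b × φ ≡ probability b
    split : ∀ {bs} → All (λ b → 0ℚ ≤ weight b) bs → Split I bs (total probability bs)
    split []          = []
    split (0≤w ∷ all) = (0≤w , refl) ∷ split all
    dominates : ∀ {b φ} → I b φ → accepted b ≤ φ
    dominates {b} (0≤w , refl) = accepted≤probability b 0≤w
    descends : ∀ {b φ} → I b φ → ∃[ ψ ] (Split I (step b) ψ × ψ ≤ φ)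
    descends {b} (0≤w , refl) = _ , split (weight-step b 0≤w) , ≤-reflexive (probability-conserved b)

  -- The value assigned to a branch bounds the expected number of steps before
  -- acceptance, weighted by the probability of the branch.
  module Drift (I : Branch → ℚ → Set)
    (0≤weight : ∀ {b w} → I b w → 0ℚ ≤ weight b)
    (0≤value  : ∀ {b w} → I b w → 0ℚ ≤ w)
    (descends : ∀ {b w} → I b w →
       (∃[ a ] state b ≡ accepting a) ⊎ (∃[ ψ ] (Split I (step b) ψ × ψ + probability b ≤ w)))
    where

    deficit : ℕ → Branch → ℚ
    deficit n b = probability b - gain n b

    -- A Markov inequality: the deficit is the weight of what has not been accepted within n steps,
    -- and the value pays `probability b` at each step. In the induction one further copy of the
    -- deficit is bounded by that payment.
    deficit≤ : ∀ n {b w} → I b w → fromℕ n * deficit n b ≤ w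
    total-deficit≤ : ∀ n {bs ψ} → Split I bs ψ →
                     fromℕ n * (total probability bs - total (gain n) bs) ≤ ψ

    deficit≤ zero    {b} i = ≤-trans (≤-reflexive (*-zeroˡ (deficit 0 b))) (0≤value i)
    deficit≤ (suc n) {b} {w} i with descends i
    ... | inj₁ (_ , q≡) = ≤-trans (≤-reflexive (begin
        fromℕ (suc n) * (probability b - gain (suc n) b)
          ≡⟨ cong (λ g → fromℕ (suc n) * (probability b - g)) (gain-accepting (suc n) b q≡) ⟩
        fromℕ (suc n) * (probability b - probability b)
          ≡⟨ cong (fromℕ (suc n) *_) (+-inverseʳ (probability b)) ⟩
        fromℕ (suc n) * 0ℚ
          ≡⟨ *-zeroʳ (fromℕ (suc n)) ⟩
        0ℚ ∎)) (0≤value i)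
      where open ≡-Reasoning
    ... | inj₂ (ψ , split , ψ+p≤w) = begin
        (1ℚ + fromℕ n) * (probability b - gain (suc n) b)
          ≡⟨ expand (fromℕ n) (probability b) (gain (suc n) b) ⟩
        fromℕ n * (probability b - gain (suc n) b) + (probability b - gain (suc n) b)
          ≡⟨ cong₂ (λ p g → fromℕ n * (p - g) + (probability b - gain (suc n) b))
               (≡.sym (probability-conserved b)) (gain-suc n b) ⟩
        fromℕ n * (total probability (step b) - total (gain n) (step b)) + (probability b - gain (suc n) b)
          ≤⟨ +-mono-≤ (total-deficit≤ n split) p-gain≤p ⟩
        ψ + probability b
          ≤⟨ ψ+p≤w ⟩
        w ∎
      where
      open ≤-Reasoning
      expand : ∀ k p g → (1ℚ + k) * (p - g) ≡ k * (p - g) + (p - g)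
      expand = solve-∀ ℚ-ring
      cancel : ∀ p g → (p - g) + g ≡ p
      cancel = solve-∀ ℚ-ring
      p-gain≤p : probability b - gain (suc n) b ≤ probability b
      p-gain≤p = ≤-from-diff (0≤-gain (suc n) b (0≤weight i)) (cancel (probability b) (gain (suc n) b))

    total-deficit≤ n []                             = ≤-reflexive (*-zeroʳ (fromℕ n))
    total-deficit≤ n (_∷_ {b} {bs} {φ} {ψ} i split) = begin
      fromℕ n * ((probability b + total probability bs) - (gain n b + total (gain n) bs))
        ≡⟨ regroup (fromℕ n) (probability b) (total probability bs) (gain n b) (total (gain n) bs) ⟩
      fromℕ n * deficit n b + fromℕ n * (total probability bs - total (gain n) bs)
        ≤⟨ +-mono-≤ (deficit≤ n i) (total-deficit≤ n split) ⟩
      φ + ψ ∎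
      where
      open ≤-Reasoning
      regroup : ∀ k p p′ g g′ → k * ((p + p′) - (g + g′)) ≡ k * (p - g) + k * (p′ - g′)
      regroup = solve-∀ ℚ-ring

-- The verifier

finite-Fin : ∀ n → Finite (Fin n)
finite-Fin n = n , ↔-id (Fin n)

finite-⊎ : Finite A → Finite B → Finite (A ⊎ B)
finite-⊎ (m , f) (n , g) = m ℕ.+ n , ↔-sym Fin.+↔⊎ ↔-∘ (f ⊎-↔ g)

finite-× : Finite A → Finite B → Finite (A × B)
finite-× (m , f) (n , g) = m ℕ.* n , ↔-sym Fin.*↔× ↔-∘ (f ×-↔ g)

finite-↔ : A ↔ B → Finite B → Finite A
finite-↔ f (n , g) = n , (g ↔-∘ f)

finite-Maybe : Finite A → Finite (Maybe A)
finite-Maybe finite = finite-↔ (mk↔ₛ′ to from to∘from from∘to) (finite-⊎ finite (finite-Fin 1))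
  where
  to : Maybe A → A ⊎ Fin 1
  to (just a) = inj₁ a
  to nothing  = inj₂ 0F
  from : A ⊎ Fin 1 → Maybe A
  from (inj₁ a) = just a
  from (inj₂ _) = nothing
  to∘from : ∀ y → to (from y) ≡ y
  to∘from (inj₁ a)  = refl
  to∘from (inj₂ 0F) = refl
  from∘to : ∀ y → from (to y) ≡ y
  from∘to (just a) = refl
  from∘to nothing  = refl

finite-Control : Finite A → Finite (Control A)
finite-Control finite = finite-↔ (mk↔ₛ′ to from to∘from from∘to) (finite-⊎ finite (finite-Fin 2))
  where
  to : Control A → A ⊎ Fin 2
  to (running a) = inj₁ a
  to accept      = inj₂ 0F
  to reject      = inj₂ 1F
  from : A ⊎ Fin 2 → Control A
  from (inj₁ a)  = running a
  from (inj₂ 0F) = accept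
  from (inj₂ 1F) = reject
  to∘from : ∀ y → to (from y) ≡ y
  to∘from (inj₁ a)  = refl
  to∘from (inj₂ 0F) = refl
  to∘from (inj₂ 1F) = refl
  from∘to : ∀ y → from (to y) ≡ y
  from∘to (running a) = refl
  from∘to accept      = refl
  from∘to reject      = refl

finite-Move : Finite Move
finite-Move = 3 , mk↔ₛ′ to from to∘from from∘to
  where
  to : Move → Fin 3
  to left  = 0F
  to stay  = 1F
  to right = 2F
  from : Fin 3 → Move
  from 0F = left
  from 1F = stay
  from 2F = right
  to∘from : ∀ y → to (from y) ≡ y
  to∘from 0F = refl
  to∘from 1F = refl
  to∘from 2F = refl
  from∘to : ∀ y → from (to y) ≡ y
  from∘to left  = refl
  from∘to stay  = refl
  from∘to right = refl

unitRow : Vector ℚ 4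
unitRow = ⟨ 1ℚ , 0ℚ , 0ℚ , 0ℚ ⟩

-- The components of the register are, up to a common factor, the constant 1,
-- the contents of the tape to the left and to the right of the head, and a
-- counter; matrices keep the first one.
keeping : Vector (Vector ℚ 4) 3 → Matrix 4
keeping R zero    = unitRow
keeping R (suc i) = R i

module Simulation {A : Set} (A-finite : Finite A) (M : TuringMachine A) where
  module M = TuringMachine M

  Letter : Set
  Letter = Maybe M.Symbol

  symbol-finite : Finite M.Symbol
  symbol-finite = finite-⊎ A-finite M.aux-finite

  letter-finite : Finite Letter
  letter-finite = finite-Maybe symbol-finite

  base : ℕ
  base = suc (proj₁ symbol-finite)

  -- Blanks have code 0, so that the tape may be extended by blanks without
  -- changing the number it is encoded by.
  code : Letter → ℕ
  code nothing  = 0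
  code (just a) = suc (toℕ (Inverse.to (proj₂ symbol-finite) a))

  -- A state, letter and move that the machine is about to go to, write and make.
  Pending : Set
  Pending = Control M.State × Letter × Move

  pending-finite : Finite Pending
  pending-finite = finite-× (finite-Control M.state-finite) (finite-× letter-finite finite-Move)

  Reading : Set
  Reading = Fin 2 ⊎ (Letter ⊎ (Pending ⊎ (Pending × Letter ⊎ Control M.State × Letter)))

  pattern seek       = inj₁ 0F
  pattern measure    = inj₁ 1F
  pattern load h     = inj₂ (inj₁ h)
  pattern tick s     = inj₂ (inj₂ (inj₁ s))
  pattern shift s a  = inj₂ (inj₂ (inj₂ (inj₁ (s , a))))
  pattern verify c h = inj₂ (inj₂ (inj₂ (inj₂ (c , h))))

  Cell : Set
  Cell = Fin 5 ⊎ (Fin 2 ⊎ Letter)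

  pattern outcome i = inj₁ i
  pattern restarted = inj₂ (inj₁ 0F)
  pattern query     = inj₂ (inj₁ 1F)
  pattern digit a   = inj₂ (inj₂ a)

  State : Set
  State = VerifierState Reading Pending (Fin 1) (Fin 1)

  showing : n ℕ.≤ 5 → Fin n ↣ Cell
  showing n≤5 = mk↣ {to = λ i → outcome (inject≤ i n≤5)} λ eq →
    Fin.inject≤-injective n≤5 n≤5 _ _ (inj₁-injective eq)

  data Action : Set where
    restart  : State → Move → Action
    gate     : Vector (Vector ℚ 4) 3 → State → Move → Action
    discard  : State → Action
    conclude : Action

  to : State → Move → Transition State (Fin 0)
  to q m = transition q nothing stay m

  -- Failure of a gate or of the final measurement leads to `seek` and costs only time. A
  -- measurement sends the verifier straight to rejection only through `discard`, whose discarded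
  -- component is zero when all claims were true.
  next : Action → (i : Fin n) → Transition State (Fin 0)
  next (restart q m)       _  = to q m
  next (gate _ q m)    1F = to q m
  next (gate _ q m)    _  = to (reading seek) stay
  next (discard q)         0F = to q stay
  next (discard q)         _  = to (rejecting 0F) stay
  next conclude            0F = to (accepting 0F) stay
  next conclude            _  = to (reading seek) stay

  operate : Action → Operation 4 Cell (Transition State (Fin 0))
  operate (restart q m) = initialize restarted (to q m)
  operate a@(gate R q m) =
    apply (Gate.superoperator (keeping R)) (showing ℕ.≤-refl) (next a)
  operate a@(discard q) = apply dropping (showing (s≤s (s≤s z≤n))) (next a)
  operate a@conclude    = apply measuring (showing (s≤s (s≤s z≤n))) (next a)

  enter : Control M.State → Letter → State
  enter (running q) h = communicating (M.δ q h)
  enter accept      h = reading measure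
  enter reject      h = rejecting 0F

  arriving : Move → (written popped : Letter) → Letter
  arriving stay w a = w
  arriving _    w a = a

  b̂ : ℚ
  b̂ = fromℕ base

  ĉ : Letter → ℚ
  ĉ h = fromℕ (code h)

  double : ℚ → ℚ
  double p = p + p

  -- The last component y becomes c + k y. With c = k = 1 this is a tick; with a code for c and the
  -- base for k it pushes a letter, which is how the input is loaded.
  counting : ℚ → ℚ → Vector (Vector ℚ 4) 3
  counting c k 0F = ⟨ 0ℚ , 1ℚ , 0ℚ , 0ℚ ⟩
  counting c k 1F = ⟨ 0ℚ , 0ℚ , 1ℚ , 0ℚ ⟩
  counting c k 2F = ⟨ c  , 0ℚ , 0ℚ , k  ⟩

  -- The component with index 1 becomes twice the error in the claim that the
  -- counter and `a` make up the part of the tape that the head moves into.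
  shifting : Move → (written popped : Letter) → Vector (Vector ℚ 4) 3
  shifting right w a 0F = ⟨ - double (ĉ a) , 0ℚ , double 1ℚ , - double b̂ ⟩
  shifting right w a 1F = ⟨ ĉ w , b̂  , 0ℚ , 0ℚ ⟩
  shifting right w a 2F = ⟨ 0ℚ  , 0ℚ , 0ℚ , 1ℚ ⟩
  shifting left  w a 0F = ⟨ - double (ĉ a) , double 1ℚ , 0ℚ , - double b̂ ⟩
  shifting left  w a 1F = ⟨ 0ℚ  , 0ℚ , 0ℚ , 1ℚ ⟩
  shifting left  w a 2F = ⟨ ĉ w , 0ℚ , b̂  , 0ℚ ⟩
  shifting stay  w a 0F = ⟨ 0ℚ  , 0ℚ , 0ℚ , 0ℚ ⟩
  shifting stay  w a 1F = ⟨ 0ℚ  , 1ℚ , 0ℚ , 0ℚ ⟩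
  shifting stay  w a 2F = ⟨ 0ℚ  , 0ℚ , 1ℚ , 0ℚ ⟩

  -- Loading needs no prover. The input is read from right to left, and a letter is pushed when its
  -- left neighbour replaces it in the state, so that the first letter is left over as the scanned
  -- one. The initial blank is pushed onto zero without effect. The number grows in the last
  -- component, and the `discard` at the left end moves it to the place of the right part of the
  -- tape.
  action : Reading → Delimited A → Action
  action seek       ⊣       = restart (reading (load nothing)) left
  action seek       _       = restart (reading seek) right
  action (load h)   (sym a) = gate (counting (ĉ h) b̂) (reading (load (just (inj₁ a)))) left
  action (load h)   _       = discard (enter M.start h)
  action (tick s)   _       = gate (counting 1ℚ 1ℚ) (communicating s) stay
  action (shift (c , w , m) a) _ = 
    gate (shifting m w a) (reading (verify c (arriving m w a))) stay
  action (verify c h) _     = discard (enter c h)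
  action measure    _       = conclude

  V : Verifier A
  V = record
    { Reading       = Reading
    ; Communicating = Pending
    ; Accepting     = Fin 1
    ; Rejecting     = Fin 1
    ; reading-finite =
        finite-⊎ (finite-Fin 2) (finite-⊎ letter-finite (finite-⊎ pending-finite
          (finite-⊎ (finite-× pending-finite letter-finite)
                    (finite-× (finite-Control M.state-finite) letter-finite))))
    ; communicating-finite = pending-finite
    ; accepting-finite     = finite-Fin 1
    ; rejecting-finite     = finite-Fin 1
    ; Cell         = Cell
    ; Work         = Fin 0
    ; cell-finite  = finite-⊎ (finite-Fin 5) (finite-⊎ (finite-Fin 2) letter-finite)
    ; work-finite  = finite-Fin 0
    ; dimension    = 4
    ; initial      = unitRow
    ; initial-unit = refl
    ; start        = reading seek
    ; δ            = λ q a _ → operate (action q a)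
    ; ask          = λ _ → query
    ; answer       = λ where
        s (digit a) → reading (shift s a)
        -- Every reply other than a letter counts as a tick, so no reply is malformed.
        s _         → reading (tick s)
    }

-- Tapes as numbers

fromℕ-+ : ∀ m n → fromℕ (m ℕ.+ n) ≡ fromℕ m + fromℕ n
fromℕ-+ zero    n = ≡.sym (+-identityˡ (fromℕ n))
fromℕ-+ (suc m) n = trans (cong (1ℚ +_) (fromℕ-+ m n)) (≡.sym (+-assoc 1ℚ (fromℕ m) (fromℕ n)))

fromℕ-* : ∀ m n → fromℕ (m ℕ.* n) ≡ fromℕ m * fromℕ n
fromℕ-* zero    n = ≡.sym (*-zeroˡ (fromℕ n))
fromℕ-* (suc m) n = begin
  fromℕ (n ℕ.+ m ℕ.* n)          ≡⟨ fromℕ-+ n (m ℕ.* n) ⟩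
  fromℕ n + fromℕ (m ℕ.* n)      ≡⟨ cong (fromℕ n +_) (fromℕ-* m n) ⟩
  fromℕ n + fromℕ m * fromℕ n    ≡⟨ factor (fromℕ m) (fromℕ n) ⟩
  (1ℚ + fromℕ m) * fromℕ n       ∎
  where
  open ≡-Reasoning
  factor : ∀ x y → y + x * y ≡ (1ℚ + x) * y
  factor = solve-∀ ℚ-ring

fromℕ-mono-≤ : ∀ {m n} → m ℕ.≤ n → fromℕ m ≤ fromℕ n
fromℕ-mono-≤ {n = n} z≤n = 0≤fromℕ n
fromℕ-mono-≤ (s≤s m≤n)   = +-monoʳ-≤ 1ℚ (fromℕ-mono-≤ m≤n)

separated-< : ∀ {m n} → m ℕ.< n → 1ℚ ≤ (fromℕ n - fromℕ m) * (fromℕ n - fromℕ m)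
separated-< {m} {n} m<n = ≤-from-diff (0≤-+ (0≤-square e) (0≤-+ 0≤e 0≤e)) (expand (fromℕ m) (fromℕ n))
  where
  e : ℚ
  e = fromℕ n - (1ℚ + fromℕ m)
  0≤e : 0ℚ ≤ e
  0≤e = 0≤-diff (fromℕ-mono-≤ m<n)
  expand : ∀ x y → 1ℚ + ((y - (1ℚ + x)) * (y - (1ℚ + x)) + ((y - (1ℚ + x)) + (y - (1ℚ + x)))) ≡ (y - x) * (y - x)
  expand = solve-∀ ℚ-ring

-- Integrality enters here: it keeps the error of a false claim away from zero, however large the
-- encoded tapes are.
separated : ∀ m n → m ≢ n → 1ℚ ≤ (fromℕ m - fromℕ n) * (fromℕ m - fromℕ n)
separated m n m≢n with ℕ.<-cmp m n
... | tri≈ _ m≡n _ = contradiction m≡n m≢n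
... | tri> _ _ n<m = separated-< n<m
... | tri< m<n _ _ = subst (1ℚ ≤_) (flip (fromℕ m) (fromℕ n)) (separated-< m<n)
  where
  flip : ∀ x y → (y - x) * (y - x) ≡ (x - y) * (x - y)
  flip = solve-∀ ℚ-ring

-- Unvisited cells count as blanks. This makes both operations total and gives `move` a single
-- equation in each direction.
top : List (Maybe B) → Maybe B
top []      = nothing
top (h ∷ _) = h

rest : List (Maybe B) → List (Maybe B)
rest []       = []
rest (_ ∷ hs) = hs

move-right : ∀ (ls rs : List (Maybe B)) h → move right (tape ls h rs) ≡ tape (h ∷ ls) (top rs) (rest rs)
move-right ls []      h = refl
move-right ls (_ ∷ _) h = refl

move-left : ∀ (ls rs : List (Maybe B)) h → move left (tape ls h rs) ≡ tape (rest ls) (top ls) (h ∷ rs)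
move-left []      rs h = refl
move-left (_ ∷ _) rs h = refl

-- Without a move nothing is popped; the empty list makes the honest prover announce a blank without
-- any ticks.
ahead : Move → Tape B → List (Maybe B)
ahead left  t = Tape.before t
ahead stay  t = []
ahead right t = Tape.after t

keeping-0 : ∀ R v → (keeping R ▷ v) 0F ≡ v 0F
keeping-0 R v = ▷-identity-row (keeping R) 0F 0F v λ { 0F → refl ; 1F → refl ; 2F → refl ; 3F → refl }

1≤size : ∀ R → 1ℚ ≤ Gate.size (keeping R)
1≤size R = ≤-from-diff (0≤-sum λ i → 0≤-‖‖² (R i)) refl

module Encoding {A : Set} (A-finite : Finite A) (M : TuringMachine A) where
  open Simulation A-finite M

  code<base : ∀ h → code h ℕ.< base
  code<base nothing  = s≤s z≤n
  code<base (just a) = s≤s (Fin.toℕ<n _)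

  code-injective : ∀ {h h′} → code h ≡ code h′ → h ≡ h′
  code-injective {nothing} {nothing} _  = refl
  code-injective {just a}  {just a′} eq =
    cong just (Injection.injective (↔⇒↣ (proj₂ symbol-finite)) (Fin.toℕ-injective (ℕ.suc-injective eq)))

  encode : List Letter → ℕ
  encode []       = 0
  encode (h ∷ hs) = code h ℕ.+ encode hs ℕ.* base

  encode-split : ∀ hs → encode hs ≡ code (top hs) ℕ.+ encode (rest hs) ℕ.* base
  encode-split []       = refl
  encode-split (h ∷ hs) = refl

  -- Codes are below the base, so the remainder recovers the letter and cancellation the rest. A
  -- claim that is numerically right is therefore right about the letter and about the counter.
  digits-unique : ∀ a y a′ y′ → code a ℕ.+ y ℕ.* base ≡ code a′ ℕ.+ y′ ℕ.* base → a ≡ a′ × y ≡ y′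
  digits-unique a y a′ y′ eq =
    code-injective a≡ , ℕ.*-cancelʳ-≡ y y′ base (ℕ.+-cancelˡ-≡ (code a) _ _ (trans eq (cong (ℕ._+ y′ ℕ.* base) (≡.sym a≡))))
    where
    open ≡-Reasoning
    a≡ : code a ≡ code a′
    a≡ = begin
      code a                                ≡⟨ ℕ.m<n⇒m%n≡m (code<base a) ⟨
      code a ℕ.% base                       ≡⟨ ℕ.[m+kn]%n≡m%n (code a) y base ⟨
      (code a ℕ.+ y ℕ.* base) ℕ.% base      ≡⟨ cong (ℕ._% base) eq ⟩
      (code a′ ℕ.+ y′ ℕ.* base) ℕ.% base    ≡⟨ ℕ.[m+kn]%n≡m%n (code a′) y′ base ⟩
      code a′ ℕ.% base                      ≡⟨ ℕ.m<n⇒m%n≡m (code<base a′) ⟩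
      code a′                               ∎

  fromℕ-digits : ∀ a y → fromℕ (code a ℕ.+ y ℕ.* base) ≡ ĉ a + fromℕ y * b̂
  fromℕ-digits a y = trans (fromℕ-+ (code a) (y ℕ.* base)) (cong (ĉ a +_) (fromℕ-* y base))

  popped : Move → Tape M.Symbol → Letter
  popped m t = top (ahead m t)

  target : Move → Tape M.Symbol → ℕ
  target m t = encode (rest (ahead m t))

  contents : Tape M.Symbol → ℚ → Vector ℚ 4
  contents t y = ⟨ 1ℚ , fromℕ (encode (Tape.before t)) , fromℕ (encode (Tape.after t)) , y ⟩

  -- The layout just before a `discard`: the component with index 1 is the error of the claim, here
  -- zero. Loading uses this layout too.
  checked : Tape M.Symbol → Vector ℚ 4
  checked t = ⟨ 1ℚ , 0ℚ , fromℕ (encode (Tape.before t)) , fromℕ (encode (Tape.after t)) ⟩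

  counting▷ : ∀ c k l r y → keeping (counting c k) ▷ ⟨ 1ℚ , l , r , y ⟩ ≗ ⟨ 1ℚ , l , r , c + y * k ⟩
  counting▷ c k l r y 0F = keeping-0 (counting c k) ⟨ 1ℚ , l , r , y ⟩
  counting▷ c k l r y 1F = lemma l r y
    where
    lemma : ∀ l r y → 0ℚ * 1ℚ + (1ℚ * l + (0ℚ * r + (0ℚ * y + 0ℚ))) ≡ l
    lemma = solve-∀ ℚ-ring
  counting▷ c k l r y 2F = lemma l r y
    where
    lemma : ∀ l r y → 0ℚ * 1ℚ + (0ℚ * l + (1ℚ * r + (0ℚ * y + 0ℚ))) ≡ r
    lemma = solve-∀ ℚ-ring
  counting▷ c k l r y 3F = lemma c k l r y
    where
    lemma : ∀ c k l r y → c * 1ℚ + (0ℚ * l + (0ℚ * r + (k * y + 0ℚ))) ≡ c + y * k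
    lemma = solve-∀ ℚ-ring

  right▷ : ∀ w a l r y → keeping (shifting right w a) ▷ ⟨ 1ℚ , l , r , y ⟩
                       ≗ ⟨ 1ℚ , double (r - (ĉ a + y * b̂)) , ĉ w + l * b̂ , y ⟩
  right▷ w a l r y 0F = keeping-0 (shifting right w a) ⟨ 1ℚ , l , r , y ⟩
  right▷ w a l r y 1F = lemma (ĉ a) b̂ l r y
    where
    lemma : ∀ c b l r y → - (c + c) * 1ℚ + (0ℚ * l + ((1ℚ + 1ℚ) * r + (- (b + b) * y + 0ℚ)))
                        ≡ (r - (c + y * b)) + (r - (c + y * b))
    lemma = solve-∀ ℚ-ring
  right▷ w a l r y 2F = lemma (ĉ w) b̂ l r y
    where
    lemma : ∀ c b l r y → c * 1ℚ + (b * l + (0ℚ * r + (0ℚ * y + 0ℚ))) ≡ c + l * b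
    lemma = solve-∀ ℚ-ring
  right▷ w a l r y 3F = lemma l r y
    where
    lemma : ∀ l r y → 0ℚ * 1ℚ + (0ℚ * l + (0ℚ * r + (1ℚ * y + 0ℚ))) ≡ y
    lemma = solve-∀ ℚ-ring

  left▷ : ∀ w a l r y → keeping (shifting left w a) ▷ ⟨ 1ℚ , l , r , y ⟩
                      ≗ ⟨ 1ℚ , double (l - (ĉ a + y * b̂)) , y , ĉ w + r * b̂ ⟩
  left▷ w a l r y 0F = keeping-0 (shifting left w a) ⟨ 1ℚ , l , r , y ⟩
  left▷ w a l r y 1F = lemma (ĉ a) b̂ l r y
    where
    lemma : ∀ c b l r y → - (c + c) * 1ℚ + ((1ℚ + 1ℚ) * l + (0ℚ * r + (- (b + b) * y + 0ℚ)))
                        ≡ (l - (c + y * b)) + (l - (c + y * b))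
    lemma = solve-∀ ℚ-ring
  left▷ w a l r y 2F = lemma l r y
    where
    lemma : ∀ l r y → 0ℚ * 1ℚ + (0ℚ * l + (0ℚ * r + (1ℚ * y + 0ℚ))) ≡ y
    lemma = solve-∀ ℚ-ring
  left▷ w a l r y 3F = lemma (ĉ w) b̂ l r y
    where
    lemma : ∀ c b l r y → c * 1ℚ + (0ℚ * l + (b * r + (0ℚ * y + 0ℚ))) ≡ c + r * b
    lemma = solve-∀ ℚ-ring

  stay▷ : ∀ w a l r y → keeping (shifting stay w a) ▷ ⟨ 1ℚ , l , r , y ⟩ ≗ ⟨ 1ℚ , 0ℚ , l , r ⟩
  stay▷ w a l r y 0F = keeping-0 (shifting stay w a) ⟨ 1ℚ , l , r , y ⟩
  stay▷ w a l r y 1F = lemma l r y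
    where
    lemma : ∀ l r y → 0ℚ * 1ℚ + (0ℚ * l + (0ℚ * r + (0ℚ * y + 0ℚ))) ≡ 0ℚ
    lemma = solve-∀ ℚ-ring
  stay▷ w a l r y 2F = lemma l r y
    where
    lemma : ∀ l r y → 0ℚ * 1ℚ + (1ℚ * l + (0ℚ * r + (0ℚ * y + 0ℚ))) ≡ l
    lemma = solve-∀ ℚ-ring
  stay▷ w a l r y 3F = lemma l r y
    where
    lemma : ∀ l r y → 0ℚ * 1ℚ + (0ℚ * l + (1ℚ * r + (0ℚ * y + 0ℚ))) ≡ r
    lemma = solve-∀ ℚ-ring

  -- The new tape is a separate argument so that the equations `move-right` and `move-left` can be
  -- substituted into it.
  ShiftedTo : Tape M.Symbol → Move → Letter → Tape M.Symbol → Letter → ℕ → Set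
  ShiftedTo t′ m w t a y =
    keeping (shifting m w a) ▷ contents t (fromℕ y) ≗ checked t′ × arriving m w a ≡ Tape.head t′

  Shifted : Move → Letter → Tape M.Symbol → Letter → ℕ → Set
  Shifted m w t = ShiftedTo (move m (write w t)) m w t

  double-zero : ∀ {n} a y → n ≡ code a ℕ.+ y ℕ.* base → double (fromℕ n - (ĉ a + fromℕ y * b̂)) ≡ 0ℚ
  double-zero a y refl = cong double (begin
    fromℕ (code a ℕ.+ y ℕ.* base) - (ĉ a + fromℕ y * b̂) ≡⟨ cong (_- (ĉ a + fromℕ y * b̂)) (fromℕ-digits a y) ⟩
    (ĉ a + fromℕ y * b̂) - (ĉ a + fromℕ y * b̂)           ≡⟨ +-inverseʳ (ĉ a + fromℕ y * b̂) ⟩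
    0ℚ                                                  ∎)
    where open ≡-Reasoning

  ⟨⟩-cong : ∀ {l l′ r r′ y y′} → l ≡ l′ → r ≡ r′ → y ≡ y′ → ⟨ p , l , r , y ⟩ ≗ ⟨ p , l′ , r′ , y′ ⟩
  ⟨⟩-cong refl refl refl _ = refl

  shifted : ∀ m w t → Shifted m w t (popped m t) (target m t)
  shifted right w t@(tape ls h rs) =
    subst (λ t′ → ShiftedTo t′ right w t (top rs) (encode (rest rs))) (≡.sym (move-right ls rs w))
      ( (λ i → trans (right▷ w (top rs) (fromℕ (encode ls)) (fromℕ (encode rs)) (fromℕ (encode (rest rs))) i)
          (⟨⟩-cong (double-zero (top rs) (encode (rest rs)) (encode-split rs)) (≡.sym (fromℕ-digits w (encode ls))) refl i))
      , refl)
  shifted left w t@(tape ls h rs) =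
    subst (λ t′ → ShiftedTo t′ left w t (top ls) (encode (rest ls))) (≡.sym (move-left ls rs w))
      ( (λ i → trans (left▷ w (top ls) (fromℕ (encode ls)) (fromℕ (encode rs)) (fromℕ (encode (rest ls))) i)
          (⟨⟩-cong (double-zero (top ls) (encode (rest ls)) (encode-split ls)) refl (≡.sym (fromℕ-digits w (encode rs))) i))
      , refl)
  shifted stay w (tape ls h rs) =
    stay▷ w nothing (fromℕ (encode ls)) (fromℕ (encode rs)) 0ℚ , refl

  4ℚ : ℚ
  4ℚ = double (double 1ℚ)

  double-apart : ∀ {n} a y → n ≢ code a ℕ.+ y ℕ.* base →
                 let e = double (fromℕ n - (ĉ a + fromℕ y * b̂)) in 4ℚ ≤ e * e
  double-apart {n} a y n≢ rewrite ≡.sym (fromℕ-digits a y) =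
    ≤-from-diff (0≤-+ (0≤-+ 0≤f 0≤f) (0≤-+ 0≤f 0≤f)) (expand (fromℕ n - fromℕ (code a ℕ.+ y ℕ.* base)))
    where
    e : ℚ
    e = fromℕ n - fromℕ (code a ℕ.+ y ℕ.* base)
    0≤f : 0ℚ ≤ e * e - 1ℚ
    0≤f = 0≤-diff (separated n (code a ℕ.+ y ℕ.* base) n≢)
    expand : ∀ e → ((1ℚ + 1ℚ) + (1ℚ + 1ℚ)) + (((e * e - 1ℚ) + (e * e - 1ℚ)) + ((e * e - 1ℚ) + (e * e - 1ℚ)))
                 ≡ (e + e) * (e + e)
    expand = solve-∀ ℚ-ring

  -- A comparison of natural numbers separates true claims from lies. Equality pins down the letter
  -- and the counter by `digits-unique`; inequality gives a doubled error with square at least 4.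
  -- Without a move there is no claim to check.
  shifted? : ∀ m w t a y → Shifted m w t a y ⊎
             (let e = (keeping (shifting m w a) ▷ contents t (fromℕ y)) 1F in 4ℚ ≤ e * e)
  shifted? right w t@(tape ls h rs) a y with encode rs ℕ.≟ code a ℕ.+ y ℕ.* base
  ... | no  n≢ = inj₂ (subst (λ e → 4ℚ ≤ e * e)
                   (≡.sym (right▷ w a (fromℕ (encode ls)) (fromℕ (encode rs)) (fromℕ y) 1F)) (double-apart a y n≢))
  ... | yes n≡ with digits-unique a y (top rs) (encode (rest rs)) (trans (≡.sym n≡) (encode-split rs))
  ...   | refl , refl = inj₁ (shifted right w t)
  shifted? left w t@(tape ls h rs) a y with encode ls ℕ.≟ code a ℕ.+ y ℕ.* base
  ... | no  n≢ = inj₂ (subst (λ e → 4ℚ ≤ e * e)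
                   (≡.sym (left▷ w a (fromℕ (encode ls)) (fromℕ (encode rs)) (fromℕ y) 1F)) (double-apart a y n≢))
  ... | yes n≡ with digits-unique a y (top ls) (encode (rest ls)) (trans (≡.sym n≡) (encode-split ls))
  ...   | refl , refl = inj₁ (shifted left w t)
  shifted? stay w (tape ls h rs) a y =
    inj₁ (stay▷ w a (fromℕ (encode ls)) (fromℕ (encode rs)) (fromℕ y) , refl)

-- One step of the verifier

¼ : ℚ
¼ = ½ * ½

toℕ-pred : (i : Fin n) → toℕ (Fin.pred i) ≡ ℕ.pred (toℕ i)
toℕ-pred zero    = refl
toℕ-pred (suc i) = Fin.toℕ-inject₁ i

toℕ-forward : (i : Fin n) → suc (toℕ i) ℕ.< n → toℕ (forward i) ≡ suc (toℕ i)
toℕ-forward {suc zero}    zero    (s≤s ())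
toℕ-forward {suc (suc n)} zero    _         = refl
toℕ-forward {suc (suc n)} (suc i) (s≤s i<n) = cong suc (toℕ-forward i i<n)

lookup-middle : (us : List A) {c : A} {vs xs : List A} → xs ≡ us ++ c ∷ vs →
                (i : Fin (length xs)) → toℕ i ≡ length us → lookup xs i ≡ c
lookup-middle []       refl zero    _  = refl
lookup-middle (u ∷ us) refl (suc i) eq = lookup-middle us refl i (ℕ.suc-injective eq)

lookup-⊢ : (x : List A) (i : Position x) → toℕ i ≡ 0 → lookup (delimit x) i ≡ ⊢
lookup-⊢ x = lookup-middle [] refl

lookup-sym : (ys : List A) {a : A} {zs x : List A} → x ≡ ys ∷ʳ a ++ zs →
             (i : Position x) → toℕ i ≡ length (ys ∷ʳ a) → lookup (delimit x) i ≡ sym a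
lookup-sym ys {a} {zs} refl i eq =
  lookup-middle (⊢ ∷ map sym ys) (cong (⊢ ∷_) split) i
    (trans eq (trans (length-++ ys) (trans (ℕ.+-comm (length ys) 1) (cong suc (≡.sym (length-map sym ys))))))
  where
  open ≡-Reasoning
  split : map sym (ys ∷ʳ a ++ zs) ++ [ ⊣ ] ≡ map sym ys ++ sym a ∷ (map sym zs ++ [ ⊣ ])
  split = begin
    map sym (ys ∷ʳ a ++ zs) ++ [ ⊣ ]           ≡⟨ cong (λ l → map sym l ++ [ ⊣ ]) (++-assoc ys [ a ] zs) ⟩
    map sym (ys ++ a ∷ zs) ++ [ ⊣ ]            ≡⟨ cong (_++ [ ⊣ ]) (map-++ sym ys (a ∷ zs)) ⟩
    (map sym ys ++ sym a ∷ map sym zs) ++ [ ⊣ ] ≡⟨ ++-assoc (map sym ys) (sym a ∷ map sym zs) [ ⊣ ] ⟩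
    map sym ys ++ sym a ∷ (map sym zs ++ [ ⊣ ]) ∎

lookup-⊣ : (x : List A) (i : Position x) → toℕ i ≡ suc (length x) → lookup (delimit x) i ≡ ⊣
lookup-⊣ x i eq = lookup-middle (⊢ ∷ map sym x) refl i (trans eq (cong suc (≡.sym (length-map sym x))))

⊣-position : (x : List A) (i : Position x) → lookup (delimit x) i ≡ ⊣ → toℕ i ≡ suc (length x)
⊣-position x (suc i) eq = cong suc (lemma x i eq)
  where
  lemma : (x : List A) (i : Fin (length (map sym x ++ [ ⊣ ]))) → lookup (map sym x ++ [ ⊣ ]) i ≡ ⊣ → toℕ i ≡ length x
  lemma []      zero    _  = refl
  lemma (a ∷ x) (suc i) eq = cong suc (lemma x i eq)

length-delimit : (x : List A) → length (delimit x) ≡ suc (suc (length x))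
length-delimit x = cong suc (trans (length-++ (map sym x)) (trans (ℕ.+-comm _ 1) (cong suc (length-map sym x))))

▷-scale : (E : Matrix d) (s : ℚ) (v : Vector ℚ d) → E ▷ (λ i → s * v i) ≗ λ a → s * (E ▷ v) a
▷-scale E s v a = trans
  (sum-cong-≗ λ b → trans (≡.sym (*-assoc (E a b) s (v b)))
    (trans (cong (_* v b) (*-comm (E a b) s)) (*-assoc s (E a b) (v b))))
  (≡.sym (*-distribˡ-sum s (λ b → E a b * v b)))

‖‖²-scale : (s : ℚ) (v : Vector ℚ d) → ‖ (λ i → s * v i) ‖² ≡ (s * s) * ‖ v ‖²
‖‖²-scale s v = trans
  (sum-cong-≗ λ i → regroup s (v i))
  (≡.sym (*-distribˡ-sum (s * s) (λ i → v i * v i)))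
  where
  regroup : ∀ s x → (s * x) * (s * x) ≡ (s * s) * (x * x)
  regroup = solve-∀ ℚ-ring

module Protocol {A : Set} (A-finite : Finite A) (M : TuringMachine A) where
  open Simulation A-finite M public
  open Encoding A-finite M public

  input : List A → Tape M.Symbol
  input x = tapeOf (map inj₁ x)

  loading▷ : ∀ a zs → keeping (counting (ĉ (Tape.head (input zs))) b̂) ▷ checked (input zs) ≗ checked (input (a ∷ zs))
  loading▷ a [] i = trans (counting▷ 0ℚ b̂ 0ℚ 0ℚ 0ℚ i)
    (⟨⟩-cong {p = 1ℚ} {0ℚ} {0ℚ} refl refl (trans (+-identityˡ (0ℚ * b̂)) (*-zeroˡ b̂)) i)
  loading▷ a (z ∷ zs) i = trans (counting▷ (ĉ (just (inj₁ z))) b̂ 0ℚ 0ℚ (fromℕ (encode (map just (map inj₁ zs)))) i)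
    (⟨⟩-cong {p = 1ℚ} {0ℚ} {0ℚ} refl refl (≡.sym (fromℕ-digits (just (inj₁ z)) (encode (map just (map inj₁ zs))))) i)

  increment▷ : ∀ t y → keeping (counting 1ℚ 1ℚ) ▷ contents t (fromℕ y) ≗ contents t (fromℕ (suc y))
  increment▷ t y i = trans (counting▷ 1ℚ 1ℚ _ _ (fromℕ y) i)
    (⟨⟩-cong {p = 1ℚ} refl refl (cong (1ℚ +_) (*-identityʳ (fromℕ y))) i)

  enter-undecided : ∀ c h a → enter c h ≢ accepting a
  enter-undecided (running q) h a ()
  enter-undecided accept      h a ()
  enter-undecided reject      h a ()

  module Branches (P : Prover V) (x : List A) where
    open Interaction V P x public
    open Branch public
    open Dynamics V P x public

    symbol : Branch → Delimited A
    symbol b = lookup (delimit x) (position b)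

    step-reading : ∀ b {q} → state b ≡ reading q → step b ≡ perform (operate (action q (symbol b))) b
    step-reading b eq = cong (λ q → stepFrom q b) eq

    step-action : ∀ b {q a} → state b ≡ reading q → action q (symbol b) ≡ a → step b ≡ perform (operate a) b
    step-action b eq refl = step-reading b eq

    -- Here `v` is the exact vector, with first component 1 on honest branches, and `s` collects the
    -- gate factors since the last initialization; `weight b * (s * s)` is then the weight by which
    -- all exact squares are multiplied.
    record Scaled (b : Branch) (s : ℚ) (v : Vector ℚ 4) : Set where
      constructor scaled
      field
        components : register b ≗ λ i → s * v i

    scaled-probability : ∀ b {s v} → Scaled b s v → probability b ≡ (weight b * (s * s)) * ‖ v ‖²
    scaled-probability b {s} {v} (scaled eq) = begin
      weight b * ‖ register b ‖²         ≡⟨ cong (weight b *_) (trans (‖‖²-cong eq) (‖‖²-scale s v)) ⟩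
      weight b * ((s * s) * ‖ v ‖²)      ≡⟨ *-assoc (weight b) (s * s) ‖ v ‖² ⟨
      (weight b * (s * s)) * ‖ v ‖²      ∎
      where open ≡-Reasoning

    gated : Vector (Vector ℚ 4) 3 → State → Move → Branch → Fin 5 → Branch
    gated R q m b = observe (Gate.superoperator (keeping R)) (showing ℕ.≤-refl) (next (gate R q m)) b

    discarded : State → Branch → Fin 2 → Branch
    discarded q b = observe dropping (showing (s≤s (s≤s z≤n))) (next (discard q)) b

    concluded : Branch → Fin 2 → Branch
    concluded b = observe measuring (showing (s≤s (s≤s z≤n))) (next conclude) b

    restarted-at : State → Move → Branch → Branch
    restarted-at q m b = record (follow (to q m) restarted b) { weight = probability b ; register = unitRow }

    restarted-probability : ∀ q m b → probability (restarted-at q m b) ≡ probability b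
    restarted-probability q m b = *-identityʳ (probability b)

    gated-scaled : ∀ {R s v v′} q m b → Scaled b s v → keeping R ▷ v ≗ v′ →
                   Scaled (gated R q m b 1F) (Gate.scale (keeping R) * s) v′
    gated-scaled {R} {s} {v} {v′} q m b (scaled eq) R▷v = scaled λ i → begin
      (Gate.operator (keeping R) 1F ▷ register b) i
        ≡⟨ Gate.main-outcome (keeping R) (register b) i ⟩
      κ * (keeping R ▷ register b) i
        ≡⟨ cong (κ *_) (trans (▷-cong (keeping R) eq i) (▷-scale (keeping R) s v i)) ⟩
      κ * (s * (keeping R ▷ v) i)
        ≡⟨ cong (λ y → κ * (s * y)) (R▷v i) ⟩
      κ * (s * v′ i)
        ≡⟨ *-assoc κ s (v′ i) ⟨
      (κ * s) * v′ i ∎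
      where
      open ≡-Reasoning
      κ : ℚ
      κ = Gate.scale (keeping R)

    discarded-scaled : ∀ {s l r y} q b → Scaled b s ⟨ 1ℚ , y , l , r ⟩ → Scaled (discarded q b 0F) s ⟨ 1ℚ , l , r , 0ℚ ⟩
    discarded-scaled {s} {l} {r} q b (scaled eq) = scaled λ i → trans (dropping-0 (register b) i) (lemma i)
      where
      lemma : ⟨ register b 0F , register b 2F , register b 3F , 0ℚ ⟩ ≗ λ i → s * ⟨ 1ℚ , l , r , 0ℚ ⟩ i
      lemma 0F = eq 0F
      lemma 1F = eq 2F
      lemma 2F = eq 3F
      lemma 3F = ≡.sym (*-zeroʳ s)

    unit-square : ∀ p → p * p + (0ℚ * 0ℚ + (0ℚ * 0ℚ + (0ℚ * 0ℚ + 0ℚ))) ≡ p * p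
    unit-square = solve-∀ ℚ-ring

    discarded-probability : ∀ q b → probability (discarded q b 1F) ≡ weight b * (register b 1F * register b 1F)
    discarded-probability q b =
      cong (weight b *_) (trans (‖‖²-cong (dropping-1 (register b))) (unit-square (register b 1F)))

    concluded-probability : ∀ b → probability (concluded b 0F) ≡ weight b * (register b 0F * register b 0F)
    concluded-probability b =
      cong (weight b *_) (trans (‖‖²-cong (measuring-0 (register b))) (unit-square (register b 0F)))

    -- All outcomes that lead back to `seek` are worth `k` times their probability, so by
    -- conservation only the main outcome needs attention. The factor is ¼ for soundness and the
    -- time bound `H` for completeness.
    module Splitting (I : Branch → ℚ → Set) (k : ℚ)
      (idle : ∀ {b} → state b ≡ reading seek → 0ℚ ≤ weight b → I b (k * probability b))
      where

      gate-split : ∀ R q m b {φ} → 0ℚ ≤ weight b → I (gated R q m b 1F) φ →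
                   Split I (perform (operate (gate R q m)) b) (φ + k * (probability b - probability (gated R q m b 1F)))
      gate-split R q m b {φ} 0≤w i = subst (Split I _) eq
        (lost 0F refl ∷ i ∷ lost 2F refl ∷ lost 3F refl ∷ lost 4F refl ∷ [])
        where
        lost : ∀ j → state (gated R q m b j) ≡ reading seek → I (gated R q m b j) (k * probability (gated R q m b j))
        lost j seeking = idle seeking 0≤w
        prob : Fin 5 → ℚ
        prob j = probability (gated R q m b j)
        regroup : ∀ k φ p₀ p₁ p₂ p₃ p₄ →
          k * p₀ + (φ + (k * p₂ + (k * p₃ + (k * p₄ + 0ℚ)))) ≡
          φ + k * ((p₀ + (p₁ + (p₂ + (p₃ + (p₄ + 0ℚ))))) - p₁)
        regroup = solve-∀ ℚ-ring
        eq : k * prob 0F + (φ + (k * prob 2F + (k * prob 3F + (k * prob 4F + 0ℚ)))) ≡ φ + k * (probability b - prob 1F)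
        eq = trans (regroup k φ (prob 0F) (prob 1F) (prob 2F) (prob 3F) (prob 4F))
          (cong (λ t → φ + k * (t - prob 1F)) (perform-conserved (operate (gate R q m)) b))

      conclude-split : ∀ b {φ} → 0ℚ ≤ weight b → I (concluded b 0F) φ →
                       Split I (perform (operate conclude) b) (φ + k * (probability b - probability (concluded b 0F)))
      conclude-split b {φ} 0≤w i = subst (Split I _) eq (i ∷ idle refl 0≤w ∷ [])
        where
        prob : Fin 2 → ℚ
        prob j = probability (concluded b j)
        regroup : ∀ k φ p₀ p₁ → φ + (k * p₁ + 0ℚ) ≡ φ + k * ((p₀ + (p₁ + 0ℚ)) - p₀)
        regroup = solve-∀ ℚ-ring
        eq : φ + (k * prob 1F + 0ℚ) ≡ φ + k * (probability b - prob 0F)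
        eq = trans (regroup k φ (prob 0F) (prob 1F))
          (cong (λ t → φ + k * (t - prob 0F)) (perform-conserved (operate conclude) b))

    discard-probability : ∀ q b → probability (discarded q b 0F) + probability (discarded q b 1F) ≡ probability b
    discard-probability q b = trans
      (cong (probability (discarded q b 0F) +_) (≡.sym (+-identityʳ (probability (discarded q b 1F)))))
      (perform-conserved (operate (discard q)) b)

-- Soundness

module Soundness {A : Set} (A-finite : Finite A) (M : TuringMachine A)
  (P : Prover (Simulation.V A-finite M)) (x : List A) (¬accepts : ¬ TuringMachine.Accepts M x) where
  open Protocol A-finite M
  open Branches P x

  data Reachable : M.Configuration → Set where
    starting : Reachable (M.start , input x)
    stepping : ∀ {c} → Reachable c → Reachable (M.step c)

  run-step : ∀ n c → M.run (suc n) c ≡ M.step (M.run n c)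
  run-step zero    c = refl
  run-step (suc n) c = run-step n (M.step c)

  reachable-run : ∀ {c} → Reachable c → ∃[ n ] M.run n (M.start , input x) ≡ c
  reachable-run starting = 0 , refl
  reachable-run (stepping r) with reachable-run r
  ... | n , eq = suc n , trans (run-step n _) (cong M.step eq)

  never-accepts : ∀ {t} → ¬ Reachable (accept , t)
  never-accepts r with reachable-run r
  ... | n , eq = ¬accepts (n , _ , eq)

  -- In `loading`, the part `zs` of the input has been read. As the left end marker has position 0,
  -- position `length ys` is that of the last letter of `ys`, or of the marker when `ys` is empty.
  -- After loading the position is arbitrary.
  data Tracks : State → Position x → Vector ℚ 4 → Set where
    loading   : ∀ ys zs {i} → toℕ i ≡ length ys → x ≡ ys ++ zs →
                Tracks (reading (load (Tape.head (input zs)))) i (checked (input zs))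
    awaiting  : ∀ {q t i} y → Reachable (running q , t) →
                Tracks (communicating (M.δ q (Tape.head t))) i (contents t (fromℕ y))
    ticking   : ∀ {q t i} y → Reachable (running q , t) →
                Tracks (reading (tick (M.δ q (Tape.head t)))) i (contents t (fromℕ y))
    moving    : ∀ {q t i} y a → Reachable (running q , t) →
                Tracks (reading (shift (M.δ q (Tape.head t)) a)) i (contents t (fromℕ y))
    verifying : ∀ {c t i} → Reachable (c , t) →
                Tracks (reading (verify c (Tape.head t))) i (checked t)

  -- Until the prover lies, acceptance is impossible.  After a lie, the
  -- branch accepts with at most the squared first component, which was paid for
  -- when the lie made the verifier reject four times as much.
  data Sound (b : Branch) (φ : ℚ) : Set where
    idle     : state b ≡ reading seek → 0ℚ ≤ weight b → ¼ * probability b ≤ φ → Sound b φ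
    rejected : ∀ {a} → state b ≡ rejecting a → 0ℚ ≤ φ → Sound b φ
    decided  : ∀ {a} → state b ≡ accepting a → probability b ≤ φ → Sound b φ
    honest   : ∀ {q s v} → state b ≡ q → Tracks q (position b) v → Scaled b s v →
               0ℚ ≤ weight b → ¼ * probability b ≤ φ → Sound b φ
    lying    : ∀ {c h} → state b ≡ reading (verify c h) →
               4ℚ * (register b 0F * register b 0F) ≤ register b 1F * register b 1F →
               0ℚ ≤ weight b → ¼ * probability b ≤ φ → Sound b φ
    cheating : (∀ a → state b ≢ accepting a) → 0ℚ ≤ weight b →
               ¼ * probability b + weight b * (register b 0F * register b 0F) ≤ φ → Sound b φ

  0≤¼ : 0ℚ ≤ ¼
  0≤¼ = toWitness {a? = 0ℚ ≤? ¼} _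

  0≤¼p : ∀ b → 0ℚ ≤ weight b → 0ℚ ≤ ¼ * probability b
  0≤¼p b 0≤w = 0≤-* 0≤¼ (0≤-probability b 0≤w)

  undecided : ∀ b {φ} → (∀ a → state b ≢ accepting a) → 0ℚ ≤ φ → acceptedIn (state b) (probability b) ≤ φ
  undecided b {φ} = lemma (state b)
    where
    lemma : ∀ q → (∀ a → q ≢ accepting a) → 0ℚ ≤ φ → acceptedIn q (probability b) ≤ φ
    lemma (reading _)       _  0≤φ = 0≤φ
    lemma (communicating _) _  0≤φ = 0≤φ
    lemma (accepting a)     ≢a _   = contradiction refl (≢a a)
    lemma (rejecting _)     _  0≤φ = 0≤φ

  tracks-undecided : ∀ {q i v} → Tracks q i v → ∀ a → q ≢ accepting a
  tracks-undecided (loading _ _ _ _) a ()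
  tracks-undecided (awaiting _ _)    a ()
  tracks-undecided (ticking _ _)     a ()
  tracks-undecided (moving _ _ _)    a ()
  tracks-undecided (verifying _)     a ()

  undecided-at : ∀ b {q} → state b ≡ q → (∀ a → q ≢ accepting a) → ∀ a → state b ≢ accepting a
  undecided-at b eq ≢a a eq′ = ≢a a (trans (≡.sym eq) eq′)

  dominates : ∀ {b φ} → Sound b φ → acceptedIn (state b) (probability b) ≤ φ
  dominates {b} (idle eq 0≤w ≤φ) =
    undecided b (undecided-at b eq λ _ ()) (≤-trans (0≤¼p b 0≤w) ≤φ)
  dominates {b} (rejected eq 0≤φ) = undecided b (undecided-at b eq λ _ ()) 0≤φ
  dominates {b} (decided eq p≤φ) =
    ≤-trans (≤-reflexive (cong (λ q → acceptedIn q (probability b)) eq)) p≤φ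
  dominates {b} (honest eq tr _ 0≤w ≤φ) =
    undecided b (undecided-at b eq (tracks-undecided tr)) (≤-trans (0≤¼p b 0≤w) ≤φ)
  dominates {b} (lying eq _ 0≤w ≤φ) =
    undecided b (undecided-at b eq λ _ ()) (≤-trans (0≤¼p b 0≤w) ≤φ)
  dominates {b} (cheating ≢a 0≤w ≤φ) =
    undecided b ≢a (≤-trans (0≤-+ (0≤¼p b 0≤w) (0≤-* 0≤w (0≤-square (register b 0F)))) ≤φ)

  Descends : Branch → ℚ → Set
  Descends b φ = ∃[ ψ ] (Split Sound (step b) ψ × ψ ≤ φ)

  descends-by : ∀ b {bs φ} → step b ≡ bs → ∃[ ψ ] (Split Sound bs ψ × ψ ≤ φ) → Descends b φ
  descends-by b refl d = d

  relax : ∀ {b φ ψ} → φ ≤ ψ → Descends b φ → Descends b ψ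
  relax φ≤ψ (χ , split , χ≤φ) = χ , split , ≤-trans χ≤φ φ≤ψ

  single : ∀ {b bs φ} → Sound b φ → bs ≡ [ b ] → ∃[ ψ ] (Split Sound bs ψ × ψ ≤ φ)
  single {φ = φ} i refl = φ + 0ℚ , i ∷ [] , ≤-reflexive (+-identityʳ φ)

  open Splitting Sound ¼ (λ seeking 0≤w → idle seeking 0≤w ≤-refl)

  seek-descends : ∀ b → state b ≡ reading seek → 0ℚ ≤ weight b → Descends b (¼ * probability b)
  seek-descends b eq 0≤w with symbol b in sym≡
  ... | ⊢     = descends-by b (step-action b eq (cong (action seek) sym≡))
        (single {b = restarted-at (reading seek) right b} (idle refl (0≤-probability b 0≤w)
          (≤-reflexive (cong (¼ *_) (restarted-probability (reading seek) right b)))) refl)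
  ... | sym a = descends-by b (step-action b eq (cong (action seek) sym≡))
        (single {b = restarted-at (reading seek) right b} (idle refl (0≤-probability b 0≤w)
          (≤-reflexive (cong (¼ *_) (restarted-probability (reading seek) right b)))) refl)
  ... | ⊣     = descends-by b (step-action b eq (cong (action seek) sym≡))
        (single {b = restarted-at (reading (load nothing)) left b}
          (honest {s = 1ℚ} refl (loading x [] at-end (≡.sym (++-identityʳ x)))
            (scaled λ { 0F → refl ; 1F → refl ; 2F → refl ; 3F → refl }) (0≤-probability b 0≤w)
            (≤-reflexive (cong (¼ *_) (restarted-probability (reading (load nothing)) left b)))) refl)
    where
    at-end : toℕ (moveInput left (position b)) ≡ length x
    at-end = trans (toℕ-pred (position b)) (cong ℕ.pred (⊣-position x (position b) sym≡))

  honest-gate : ∀ {b q R q′ m s v v′} → 0ℚ ≤ weight b → state b ≡ reading q →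
    action q (symbol b) ≡ gate R q′ m → Scaled b s v → keeping R ▷ v ≗ v′ →
    (∀ {b′ s′ φ} → state b′ ≡ q′ → position b′ ≡ moveInput m (position b) → Scaled b′ s′ v′ →
       0ℚ ≤ weight b′ → ¼ * probability b′ ≤ φ → Sound b′ φ) →
    Descends b (¼ * probability b)
  honest-gate {b} {q} {R} {q′} {m} {s} {v} {v′} 0≤w eq act sc R▷v sound =
    descends-by b (step-action b eq act)
      (_ , gate-split R q′ m b 0≤w (sound {b′} refl refl (gated-scaled q′ m b sc R▷v) 0≤w ≤-refl)
         , ≤-reflexive (cancel ¼ (probability b) (probability b′)))
    where
    b′ : Branch
    b′ = gated R q′ m b 1F
    cancel : ∀ k p p′ → k * p′ + k * (p - p′) ≡ k * p
    cancel = solve-∀ ℚ-ring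

  honest-enter : ∀ {b q c t s} → 0ℚ ≤ weight b → state b ≡ reading q →
    action q (symbol b) ≡ discard (enter c (Tape.head t)) → Scaled b s (checked t) → Reachable (c , t) →
    Descends b (¼ * probability b)
  honest-enter {b} {q} {c} {t} {s} 0≤w eq act sc r =
    descends-by b (step-action b eq act)
      (_ , entered c r ∷ rejected refl ≤-refl ∷ [] , bound)
    where
    main : Control M.State → Branch
    main c = discarded (enter c (Tape.head t)) b 0F
    entered : ∀ c → Reachable (c , t) → Sound (main c) (¼ * probability (main c))
    entered (running q) r = honest refl (awaiting 0 r)
      (discarded-scaled (enter (running q) (Tape.head t)) b sc) 0≤w ≤-refl
    -- Here it matters that the machine does not accept `x`: an honest simulation never reaches the
    -- final measurement.
    entered accept      r = contradiction r never-accepts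
    entered reject      r = rejected refl (0≤¼p (main reject) 0≤w)
    fail : Branch
    fail = discarded (enter c (Tape.head t)) b 1F
    expand : ∀ k p p′ → (k * p + (0ℚ + 0ℚ)) + k * p′ ≡ k * (p + p′)
    expand = solve-∀ ℚ-ring
    bound : ¼ * probability (main c) + (0ℚ + 0ℚ) ≤ ¼ * probability b
    bound = ≤-from-diff (0≤¼p fail 0≤w)
      (trans (expand ¼ (probability (main c)) (probability fail))
        (cong (¼ *_) (discard-probability (enter c (Tape.head t)) b)))

  4·¼ : ∀ u → u ≡ ¼ * (4ℚ * u)
  4·¼ u = trans (≡.sym (*-identityˡ u)) (*-assoc ¼ 4ℚ u)

  -- The exact balance behind two estimates. The rejected weight w e² frees ¼ w e² of the value. If
  -- a lie has just been told, this covers the new term w u², as e² is at least 4 u²; if that term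
  -- is already part of the value, the freed amount is surplus.
  discard-cheats : ∀ {b q q′} → 0ℚ ≤ weight b → state b ≡ reading q → action q (symbol b) ≡ discard q′ →
    (∀ a → q′ ≢ accepting a) →
    let w = weight b ; u = register b 0F ; e = register b 1F in
    ∃[ ψ ] (Split Sound (step b) ψ × ψ + ¼ * (w * (e * e)) ≡ ¼ * probability b + w * (u * u))
  discard-cheats {b} {q} {q′} 0≤w eq act undecided =
    ψ , subst (λ bs → Split Sound bs ψ) (≡.sym (step-action b eq act))
          (cheating undecided 0≤w (≤-reflexive main-value) ∷ rejected refl ≤-refl ∷ [])
      , (begin
          ψ + ¼ * (w * (e * e))
            ≡⟨ cong (λ p → ψ + ¼ * p) (discarded-probability q′ b) ⟨
          ψ + ¼ * probability fail
            ≡⟨ expand ¼ (probability main) (w * (u * u)) (probability fail) ⟩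
          ¼ * (probability main + probability fail) + w * (u * u)
            ≡⟨ cong (λ p → ¼ * p + w * (u * u)) (discard-probability q′ b) ⟩
          ¼ * probability b + w * (u * u) ∎)
    where
    open ≡-Reasoning
    w u e ψ : ℚ
    w = weight b
    u = register b 0F
    e = register b 1F
    main fail : Branch
    main = discarded q′ b 0F
    fail = discarded q′ b 1F
    ψ = (¼ * probability main + w * (u * u)) + (0ℚ + 0ℚ)
    main-value : ¼ * probability main + w * (register main 0F * register main 0F) ≡ ¼ * probability main + w * (u * u)
    main-value = cong (λ y → ¼ * probability main + w * (y * y)) (dropping-0 (register b) 0F)
    expand : ∀ k p c p′ → ((k * p + c) + (0ℚ + 0ℚ)) + k * p′ ≡ k * (p + p′) + c
    expand = solve-∀ ℚ-ring

  cheating-discard : ∀ {b q q′} → 0ℚ ≤ weight b → state b ≡ reading q → action q (symbol b) ≡ discard q′ →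
    (∀ a → q′ ≢ accepting a) → Descends b (¼ * probability b + weight b * (register b 0F * register b 0F))
  cheating-discard {b} 0≤w eq act undecided =
    let ψ , split , eq′ = discard-cheats {b} 0≤w eq act undecided in
    ψ , split , ≤-from-diff (0≤-* 0≤¼ (0≤-* 0≤w (0≤-square (register b 1F)))) eq′

  lying-discard : ∀ {b q q′} → 0ℚ ≤ weight b → state b ≡ reading q → action q (symbol b) ≡ discard q′ →
    (∀ a → q′ ≢ accepting a) →
    4ℚ * (register b 0F * register b 0F) ≤ register b 1F * register b 1F → Descends b (¼ * probability b)
  lying-discard {b} 0≤w eq act undecided 4u²≤e² =
    let ψ , split , eq′ = discard-cheats {b} 0≤w eq act undecided in
    ψ , split , ≤-from-diff
        (0≤-* 0≤¼ (0≤-* 0≤w (0≤-diff 4u²≤e²)))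
        (cancel ψ ¼ w (e * e) (u * u) 4ℚ (¼ * probability b) eq′ (4·¼ (w * (u * u))))
    where
    w u e : ℚ
    w = weight b
    u = register b 0F
    e = register b 1F
    expand : ∀ ψ k w e u f → ψ + k * (w * (e - f * u)) ≡ (ψ + k * (w * e)) - k * (f * (w * u))
    expand = solve-∀ ℚ-ring
    drop : ∀ p u → (p + u) - u ≡ p
    drop = solve-∀ ℚ-ring
    cancel : ∀ ψ k w e u f p → ψ + k * (w * e) ≡ p + w * u → w * u ≡ k * (f * (w * u)) →
             ψ + k * (w * (e - f * u)) ≡ p
    cancel ψ k w e u f p eq₁ eq₂ = begin
      ψ + k * (w * (e - f * u))                   ≡⟨ expand ψ k w e u f ⟩
      (ψ + k * (w * e)) - k * (f * (w * u))       ≡⟨ cong₂ _-_ eq₁ (≡.sym eq₂) ⟩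
      (p + w * u) - w * u                         ≡⟨ drop p (w * u) ⟩
      p                                           ∎
      where open ≡-Reasoning

  -- The matrix keeps the first component and the gate multiplies it by κ with κ² at most 1, so the
  -- slack is w u² (1 - κ²).
  cheating-gate : ∀ {b q R q′ m} → 0ℚ ≤ weight b → state b ≡ reading q → action q (symbol b) ≡ gate R q′ m →
    (∀ a → q′ ≢ accepting a) → Descends b (¼ * probability b + weight b * (register b 0F * register b 0F))
  cheating-gate {b} {q} {R} {q′} {m} 0≤w eq act undecided =
    descends-by b (step-action b eq act)
      (_ , gate-split R q′ m b 0≤w (cheating undecided 0≤w ≤-refl)
         , ≤-from-diff (0≤-* (0≤-* 0≤w (0≤-square u)) (0≤-diff (Gate.scale²≤1 (keeping R) (1≤size R))))
             (trans (cong (λ y → ((¼ * probability b′ + w * (y * y)) + ¼ * (probability b - probability b′))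
                               + (w * (u * u)) * (1ℚ - κ * κ)) main-0)
               (expand ¼ (probability b′) (probability b) w κ u)))
    where
    w u κ : ℚ
    w = weight b
    u = register b 0F
    κ = Gate.scale (keeping R)
    b′ : Branch
    b′ = gated R q′ m b 1F
    main-0 : register b′ 0F ≡ κ * u
    main-0 = trans (Gate.main-outcome (keeping R) (register b) 0F) (cong (κ *_) (keeping-0 R (register b)))
    expand : ∀ k p′ p w κ u → ((k * p′ + w * ((κ * u) * (κ * u))) + k * (p - p′)) + (w * (u * u)) * (1ℚ - κ * κ)
                            ≡ k * p + w * (u * u)
    expand = solve-∀ ℚ-ring

  -- The weight accepted is exactly the w u² set aside for it; what remains starts anew at a quarter
  -- of its probability.
  cheating-conclude : ∀ {b q} → 0ℚ ≤ weight b → state b ≡ reading q → action q (symbol b) ≡ conclude →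
    Descends b (¼ * probability b + weight b * (register b 0F * register b 0F))
  cheating-conclude {b} 0≤w eq act =
    descends-by b (step-action b eq act)
      (_ , conclude-split b 0≤w (decided refl ≤-refl)
         , ≤-from-diff (0≤¼p b′ 0≤w)
             (trans (expand ¼ (probability b′) (probability b)) (cong (¼ * probability b +_) (concluded-probability b))))
    where
    b′ : Branch
    b′ = concluded b 0F
    expand : ∀ k p′ p → (p′ + k * (p - p′)) + k * p′ ≡ k * p + p′
    expand = solve-∀ ℚ-ring

  answer-undecided : ∀ s c a → Verifier.answer V s c ≢ accepting a
  answer-undecided s (outcome _) a ()
  answer-undecided s restarted   a ()
  answer-undecided s query       a ()
  answer-undecided s (digit _)   a ()

  cheating-descends : ∀ b q → state b ≡ q → (∀ a → q ≢ accepting a) → 0ℚ ≤ weight b →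
    Descends b (¼ * probability b + weight b * (register b 0F * register b 0F))
  cheating-descends b (reading seek) eq _ 0≤w =
    relax {b} (≤-from-diff (0≤-* 0≤w (0≤-square (register b 0F))) refl) (seek-descends b eq 0≤w)
  cheating-descends b (reading measure)      eq _ 0≤w = cheating-conclude 0≤w eq refl
  cheating-descends b (reading (load h)) eq _ 0≤w with symbol b in sym≡
  ... | ⊢     = cheating-discard 0≤w eq (cong (action (load h)) sym≡) (enter-undecided M.start h)
  ... | ⊣     = cheating-discard 0≤w eq (cong (action (load h)) sym≡) (enter-undecided M.start h)
  ... | sym a = cheating-gate 0≤w eq (cong (action (load h)) sym≡) (λ _ ())
  cheating-descends b (reading (tick s))     eq _ 0≤w = cheating-gate 0≤w eq refl (λ _ ())
  cheating-descends b (reading (shift s a))  eq _ 0≤w = cheating-gate 0≤w eq refl (λ _ ())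
  cheating-descends b (reading (verify c h)) eq _ 0≤w = cheating-discard 0≤w eq refl (enter-undecided c h)
  cheating-descends b (communicating s) eq _ 0≤w =
    descends-by b (cong (λ q → stepFrom q b) eq)
      (single {b = communicate s b} (cheating (answer-undecided s (P x (query ∷ history b))) 0≤w ≤-refl) refl)
  cheating-descends b (accepting a) eq ≢a 0≤w = contradiction refl (≢a a)
  cheating-descends b (rejecting a) eq _ 0≤w =
    descends-by b (cong (λ q → stepFrom q b) eq)
      (single {b = b} (rejected eq (0≤-+ (0≤¼p b 0≤w) (0≤-* 0≤w (0≤-square (register b 0F))))) refl)

  answered : ∀ {q t i} y c → Reachable (running q , t) →
             Tracks (Verifier.answer V (M.δ q (Tape.head t)) c) i (contents t (fromℕ y))
  answered y (outcome _) r = ticking y r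
  answered y restarted   r = ticking y r
  answered y query       r = ticking y r
  answered y (digit a)   r = moving y a r

  -- The first exact component is 1 and is kept, so the actual first component is the common factor
  -- s itself, and the actual error is s times the exact one.
  lie-detected : ∀ {b s R v} → Scaled b s (keeping R ▷ v) → v 0F ≡ 1ℚ →
    (let e = (keeping R ▷ v) 1F in 4ℚ ≤ e * e) →
    4ℚ * (register b 0F * register b 0F) ≤ register b 1F * register b 1F
  lie-detected {b} {s} {R} {v} (scaled eq) v₀≡1 4≤e² =
    ≤-from-diff (0≤-* (0≤-square s) (0≤-diff 4≤e²)) (begin
      4ℚ * (register b 0F * register b 0F) + (s * s) * (e * e - 4ℚ)
        ≡⟨ cong (λ u → 4ℚ * (u * u) + (s * s) * (e * e - 4ℚ)) u≡s ⟩
      4ℚ * (s * s) + (s * s) * (e * e - 4ℚ)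
        ≡⟨ expand 4ℚ s e ⟩
      (s * e) * (s * e)
        ≡⟨ cong (λ y → y * y) (eq 1F) ⟨
      register b 1F * register b 1F ∎)
    where
    open ≡-Reasoning
    e : ℚ
    e = (keeping R ▷ v) 1F
    u≡s : register b 0F ≡ s
    u≡s = trans (eq 0F) (trans (cong (s *_) (trans (keeping-0 R v) v₀≡1)) (*-identityʳ s))
    expand : ∀ f s e → f * (s * s) + (s * s) * (e * e - f) ≡ (s * e) * (s * e)
    expand = solve-∀ ℚ-ring

  honest-descends : ∀ {b q s v} → state b ≡ q → Tracks q (position b) v → Scaled b s v →
                    0ℚ ≤ weight b → Descends b (¼ * probability b)
  honest-descends {b} eq (loading ys zs i≡ x≡) sc 0≤w with initLast ys
  ... | [] = honest-enter 0≤w eq (cong (action (load (Tape.head (input zs)))) (lookup-⊢ x (position b) i≡)) sc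
               (subst (λ y → Reachable (M.start , input y)) x≡ starting)
  ... | ys′ ∷ʳ′ a = honest-gate 0≤w eq
          (cong (action (load (Tape.head (input zs)))) (lookup-sym ys′ x≡ (position b) i≡)) sc (loading▷ a zs)
          λ eq′ pos≡ sc′ 0≤w′ ≤φ → honest eq′
            (loading ys′ (a ∷ zs) (trans (cong toℕ pos≡) moved) (trans x≡ (++-assoc ys′ [ a ] zs))) sc′ 0≤w′ ≤φ
    where
    moved : toℕ (Fin.pred (position b)) ≡ length ys′
    moved = trans (toℕ-pred (position b)) (cong ℕ.pred (trans i≡ (trans (length-++ ys′) (ℕ.+-comm (length ys′) 1))))
  honest-descends {b} {s = s} eq (awaiting {q} {t} y r) sc 0≤w =
    descends-by b (cong (λ q → stepFrom q b) eq)
      (single {b = communicate (M.δ q (Tape.head t)) b}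
        (honest {s = s} refl (answered y (P x (query ∷ history b)) r) (scaled (Scaled.components sc)) 0≤w ≤-refl) refl)
  honest-descends {b} eq (ticking {t = t} y r) sc 0≤w =
    honest-gate 0≤w eq refl sc (increment▷ t y)
      λ eq′ _ sc′ 0≤w′ ≤φ → honest eq′ (awaiting (suc y) r) sc′ 0≤w′ ≤φ
  honest-descends {b} eq (moving {q} {t} y a r) sc 0≤w = lemma (shifted? m w t a y)
    where
    c = proj₁ (M.δ q (Tape.head t))
    w = proj₁ (proj₂ (M.δ q (Tape.head t)))
    m = proj₂ (proj₂ (M.δ q (Tape.head t)))
    lemma : Shifted m w t a y ⊎ _ → Descends b (¼ * probability b)
    lemma (inj₁ (correct , arrived)) = honest-gate 0≤w eq refl sc correct
      λ eq′ _ sc′ 0≤w′ ≤φ →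
        honest (trans eq′ (cong (λ h → reading (verify c h)) arrived)) (verifying (stepping r)) sc′ 0≤w′ ≤φ
    -- The only passage from honest to lying. The exact vector is left as the matrix produces it,
    -- since only its first two components matter from here on.
    lemma (inj₂ 4≤e²) = honest-gate 0≤w eq refl sc (λ _ → refl)
      λ eq′ _ sc′ 0≤w′ ≤φ → lying eq′ (lie-detected {v = contents t (fromℕ y)} sc′ refl 4≤e²) 0≤w′ ≤φ
  honest-descends {b} eq (verifying r) sc 0≤w = honest-enter 0≤w eq refl sc r

  descends : ∀ {b φ} → Sound b φ → Descends b φ
  descends {b} (idle eq 0≤w ≤φ)           = relax {b} ≤φ (seek-descends b eq 0≤w)
  descends {b} (rejected eq 0≤φ)          =
    descends-by b (cong (λ q → stepFrom q b) eq) (single {b = b} (rejected eq 0≤φ) refl)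
  descends {b} (decided eq p≤φ)           =
    descends-by b (cong (λ q → stepFrom q b) eq) (single {b = b} (decided eq p≤φ) refl)
  descends {b} (honest eq tr sc 0≤w ≤φ)   = relax {b} ≤φ (honest-descends eq tr sc 0≤w)
  descends {b} (lying {c} {h} eq 4u²≤e² 0≤w ≤φ) =
    relax {b} ≤φ (lying-discard 0≤w eq refl (enter-undecided c h) 4u²≤e²)
  descends {b} (cheating ≢a 0≤w ≤φ)       = relax {b} ≤φ (cheating-descends b (state b) refl ≢a 0≤w)

  soundness : AcceptsWithProbabilityAtMost ¼
  soundness n = Supermartingale.gain≤ Sound dominates descends n (idle refl 0≤1 ≤-refl)

-- Completeness

term≤sum : {f : Vector ℚ n} → (∀ i → 0ℚ ≤ f i) → ∀ i → f i ≤ sum f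
term≤sum {f = f} 0≤f zero    = ≤-from-diff (0≤-sum (0≤f ∘ suc)) refl
term≤sum {f = f} 0≤f (suc i) = ≤-trans (term≤sum (0≤f ∘ suc) i)
  (≤-from-diff (0≤f zero) (+-comm (sum (f ∘ suc)) (f zero)))

outcome-contracts : (𝓔 : Superoperator d) (i : Fin (Superoperator.outcomes 𝓔)) (v : Vector ℚ d) →
                    ‖ Superoperator.operator 𝓔 i ▷ v ‖² ≤ ‖ v ‖²
outcome-contracts 𝓔 i v = ≤-trans
  (term≤sum (λ j → 0≤-‖‖² (Superoperator.operator 𝓔 j ▷ v)) i)
  (≤-reflexive (total-probability 𝓔 v))

gate-contracts : ∀ M {v v′} → M ▷ v ≗ v′ → (Gate.scale M * Gate.scale M) * ‖ v′ ‖² ≤ ‖ v ‖²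
gate-contracts M {v} {v′} Mv≗v′ = ≤-trans
  (≤-reflexive (≡.sym (trans
    (‖‖²-cong λ i → trans (Gate.main-outcome M v i) (cong (Gate.scale M *_) (Mv≗v′ i)))
    (‖‖²-scale (Gate.scale M) v′))))
  (outcome-contracts (Gate.superoperator M) 1F v)

module HonestProver {A : Set} (A-finite : Finite A) (M : TuringMachine A) where
  open Protocol A-finite M

  -- The configuration reached by the machine, and the number of ticks sent since.
  Progress : Set
  Progress = M.Configuration × ℕ

  beginning : List A → Progress
  beginning x = (M.start , input x) , 0

  remaining : Progress → ℕ
  remaining ((running q , t) , y) = target (proj₂ (proj₂ (M.δ q (Tape.head t)))) t ℕ.∸ y
  remaining _                     = 0

  announced : Progress → Letter
  announced ((running q , t) , y) = popped (proj₂ (proj₂ (M.δ q (Tape.head t)))) t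
  announced _                     = nothing

  -- The number of missing ticks is an argument, so that an equation for `remaining` determines both
  -- the reply and the progress by congruence.
  replyAfter : ℕ → Progress → Cell
  replyAfter zero    g = digit (announced g)
  replyAfter (suc _) g = outcome 0F

  advanceAfter : ℕ → Progress → Progress
  advanceAfter zero    (c , y) = M.step c , 0
  advanceAfter (suc _) (c , y) = c , suc y

  reply : Progress → Cell
  reply g = replyAfter (remaining g) g

  advance : Progress → Progress
  advance g = advanceAfter (remaining g) g

  -- A prover sees only the history, so the state of the simulation is recomputed from it. Queries
  -- alone drive it forward; outcomes and the prover's own replies are skipped, ticks among them
  -- because a tick is sent as an outcome symbol. A failure needs no treatment: the verifier asks
  -- nothing before it has shown `restarted`.
  progress : List A → List Cell → Progress
  progress x []                = beginning x
  progress x (outcome _ ∷ h)   = progress x h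
  progress x (restarted ∷ h)   = beginning x
  progress x (query ∷ h)       = advance (progress x h)
  progress x (digit _ ∷ h)     = progress x h

  P : Prover V
  P x (query ∷ h) = reply (progress x h)
  P x _           = outcome 0F

  progress-reply : ∀ x h g → progress x (reply g ∷ h) ≡ progress x h
  progress-reply x h g with remaining g
  ... | zero  = refl
  ... | suc _ = refl

module Completeness {A : Set} (A-finite : Finite A) (M : TuringMachine A) (x : List A) where
  open HonestProver A-finite M
  open Protocol A-finite M
  open Branches P x

  κ² : Vector (Vector ℚ 4) 3 → ℚ
  κ² R = Gate.scale (keeping R) * Gate.scale (keeping R)

  0<κ² : ∀ R → 0ℚ < κ² R
  0<κ² R = 0<-* (Gate.0<scale (keeping R)) (Gate.0<scale (keeping R))

  -- The way to acceptance when no outcome makes the verifier start anew.  From a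
  -- register v it is taken to the end with weight α, and γ is the weight of the
  -- branches on the way, summed over all steps.
  data Path : State → Position x → Vector ℚ 4 → Progress → (α γ : ℚ) → Set where
    measured  : ∀ {i v g} → v 0F ≡ 1ℚ → Path (reading measure) i v g 1ℚ ‖ v ‖²
    gating    : ∀ {q i v g R q′ m v′ α γ} → action q (lookup (delimit x) i) ≡ gate R q′ m → keeping R ▷ v ≗ v′ →
                Path q′ (moveInput m i) v′ g α γ → Path (reading q) i v g (κ² R * α) (‖ v ‖² + κ² R * γ)
    discarding : ∀ {q i g q′ l r α γ} → action q (lookup (delimit x) i) ≡ discard q′ →
                Path q′ i ⟨ 1ℚ , l , r , 0ℚ ⟩ g α γ →
                Path (reading q) i ⟨ 1ℚ , 0ℚ , l , r ⟩ g α (‖ ⟨ 1ℚ , 0ℚ , l , r ⟩ ‖² + γ)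
    asked     : ∀ {s i v g c g′ α γ} → reply g ≡ c → advance g ≡ g′ →
                Path (Verifier.answer V s c) i v g′ α γ → Path (communicating s) i v g α (‖ v ‖² + γ)

  0<α : ∀ {q i v g α γ} → Path q i v g α γ → 0ℚ < α
  0<α (measured _)        = 0<1
  0<α (gating {R = R} _ _ p) = 0<-* (0<κ² R) (0<α p)
  0<α (discarding _ p)    = 0<α p
  0<α (asked _ _ p)       = 0<α p

  0≤γ : ∀ {q i v g α γ} → Path q i v g α γ → 0ℚ ≤ γ
  0≤γ (measured {v = v} _)           = 0≤-‖‖² v
  0≤γ (gating {v = v} {R = R} _ _ p) = 0≤-+ (0≤-‖‖² v) (0≤-* (<⇒≤ (0<κ² R)) (0≤γ p))
  0≤γ (discarding {l = l} {r = r} _ p) = 0≤-+ (0≤-‖‖² ⟨ 1ℚ , 0ℚ , l , r ⟩) (0≤γ p)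
  0≤γ (asked {v = v} _ _ p)          = 0≤-+ (0≤-‖‖² v) (0≤γ p)

  -- Each outcome contracts the norm, and the final weight 1 is the square of one component. This
  -- keeps the values in the time bound nonnegative and gives `α₀≤1`.
  α≤‖v‖² : ∀ {q i v g α γ} → Path q i v g α γ → α ≤ ‖ v ‖²
  α≤‖v‖² (measured {v = v} v₀≡1) = ≤-trans (≤-reflexive (cong (λ y → y * y) (≡.sym v₀≡1)))
    (term≤sum {f = λ i → v i * v i} (λ i → 0≤-square (v i)) 0F)
  α≤‖v‖² (gating {v = v} {R = R} _ Rv≗v′ p) = ≤-trans
    (*-monoˡ-≤-nonNeg (κ² R) {{nonNegative (<⇒≤ (0<κ² R))}} (α≤‖v‖² p))
    (gate-contracts (keeping R) {v} Rv≗v′)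
  α≤‖v‖² (discarding {l = l} {r = r} _ p) = ≤-trans (α≤‖v‖² p) (≤-reflexive (same 1ℚ l r))
    where
    same : ∀ u l r → u * u + (l * l + (r * r + (0ℚ * 0ℚ + 0ℚ))) ≡ u * u + (0ℚ * 0ℚ + (l * l + (r * r + 0ℚ)))
    same = solve-∀ ℚ-ring
  α≤‖v‖² (asked _ _ p) = α≤‖v‖² p

  PathFrom : State → Position x → Vector ℚ 4 → Progress → Set
  PathFrom q i v g = ∃[ α ] ∃[ γ ] Path q i v g α γ

  gating′ : ∀ {q i v g R q′ m v′} → action q (lookup (delimit x) i) ≡ gate R q′ m → keeping R ▷ v ≗ v′ →
            PathFrom q′ (moveInput m i) v′ g → PathFrom (reading q) i v g
  gating′ act Rv (_ , _ , p) = _ , _ , gating act Rv p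

  discarding′ : ∀ {q i g q′ l r} → action q (lookup (delimit x) i) ≡ discard q′ →
                PathFrom q′ i ⟨ 1ℚ , l , r , 0ℚ ⟩ g → PathFrom (reading q) i ⟨ 1ℚ , 0ℚ , l , r ⟩ g
  discarding′ act (_ , _ , p) = _ , _ , discarding act p

  asked′ : ∀ {s i v g c g′} → reply g ≡ c → advance g ≡ g′ →
           PathFrom (Verifier.answer V s c) i v g′ → PathFrom (communicating s) i v g
  asked′ reply≡ advance≡ (_ , _ , p) = _ , _ , asked reply≡ advance≡ p

  module _ (q : M.State) (t : Tape M.Symbol) where
    private
      pending = M.δ q (Tape.head t)
      c′ = proj₁ pending
      w = proj₁ (proj₂ pending)
      m = proj₂ (proj₂ pending)
      t′ = move m (write w t)

    -- Induction on the number `k` of ticks still to be sent; at zero the counter equals the target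
    -- and the true letter is announced.
    path-await : ∀ i k y → y ℕ.+ k ≡ target m t →
                 PathFrom (enter c′ (Tape.head t′)) i (contents t′ 0ℚ) ((c′ , t′) , 0) →
                 PathFrom (communicating pending) i (contents t (fromℕ y)) ((running q , t) , y)
    path-await i zero y y≡ p =
      asked′ {c = digit (popped m t)} (cong (λ k → replyAfter k g) none) (cong (λ k → advanceAfter k g) none)
        (gating′ refl Rv (discarding′ {q = verify c′ (arriving m w (popped m t))} refl
          (subst (λ h → PathFrom (enter c′ h) i (contents t′ 0ℚ) ((c′ , t′) , 0)) (≡.sym (proj₂ (shifted m w t))) p)))
      where
      g : Progress
      g = (running q , t) , y
      y≡target : y ≡ target m t
      y≡target = trans (≡.sym (ℕ.+-identityʳ y)) y≡
      none : target m t ℕ.∸ y ≡ 0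
      none = trans (cong (ℕ._∸ y) (≡.sym y≡target)) (ℕ.n∸n≡0 y)
      Rv : keeping (shifting m w (popped m t)) ▷ contents t (fromℕ y) ≗ checked t′
      Rv = subst (λ y → keeping (shifting m w (popped m t)) ▷ contents t (fromℕ y) ≗ checked t′)
             (≡.sym y≡target) (proj₁ (shifted m w t))
    path-await i (suc k) y y≡ p =
      asked′ {c = outcome 0F} (cong (λ k → replyAfter k g) some) (cong (λ k → advanceAfter k g) some)
        (gating′ refl (increment▷ t y) (path-await i k (suc y) (trans (≡.sym (ℕ.+-suc y k)) y≡) p))
      where
      g : Progress
      g = (running q , t) , y
      some : target m t ℕ.∸ y ≡ suc k
      some = trans (cong (ℕ._∸ y) (≡.sym y≡)) (ℕ.m+n∸m≡n y (suc k))

  run-reject : ∀ n t → M.run n (reject , t) ≡ (reject , t)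
  run-reject zero    t = refl
  run-reject (suc n) t = run-reject n t

  path-enter : ∀ n c t {t′ i} → M.run n (c , t) ≡ (accept , t′) →
               PathFrom (enter c (Tape.head t)) i (contents t 0ℚ) ((c , t) , 0)
  path-enter n accept t _ = _ , _ , measured refl
  path-enter n reject t eq with () ← trans (≡.sym (run-reject n t)) eq
  path-enter (suc n) (running q) t eq =
    path-await q t _ _ 0 refl (path-enter n _ _ eq)

  module _ {n t} (run≡ : M.run n (M.start , input x) ≡ (accept , t)) where

    path-load : ∀ k ys zs {i} → length ys ≡ k → toℕ i ≡ length ys → x ≡ ys ++ zs →
                PathFrom (reading (load (Tape.head (input zs)))) i (checked (input zs)) (beginning x)
    path-load zero [] zs {i} _ i≡ refl =
      discarding′ (cong (action (load (Tape.head (input zs)))) (lookup-⊢ x i i≡)) (path-enter n M.start (input x) run≡)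
    path-load (suc k) ys zs {i} len i≡ x≡ with initLast ys
    ... | ys′ ∷ʳ′ a = gating′ (cong (action (load (Tape.head (input zs)))) (lookup-sym ys′ x≡ i i≡)) (loading▷ a zs)
      (path-load k ys′ (a ∷ zs) (ℕ.suc-injective (trans (≡.sym len-∷ʳ) len))
        (trans (toℕ-pred i) (cong ℕ.pred (trans i≡ len-∷ʳ))) (trans x≡ (++-assoc ys′ [ a ] zs)))
      where
      len-∷ʳ : length (ys′ ∷ʳ a) ≡ suc (length ys′)
      len-∷ʳ = trans (length-++ ys′) (ℕ.+-comm (length ys′) 1)

-- Expected time of the honest interaction

module Recurrence {A : Set} (A-finite : Finite A) (M : TuringMachine A) (x : List A)
  {n t} (run≡ : TuringMachine.run M n (TuringMachine.start M , tapeOf (map inj₁ x)) ≡ (accept , t)) where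
  open HonestProver A-finite M
  open Protocol A-finite M
  open Branches P x
  open Completeness A-finite M x

  private
    startPosition : Position x
    startPosition = Fin.fromℕ< {length x}
      (subst (length x ℕ.<_) (≡.sym (length-delimit x)) (ℕ.m<n⇒m<1+n (ℕ.n<1+n (length x))))

    startPath : PathFrom (reading (load nothing)) startPosition (checked (input [])) (beginning x)
    startPath = path-load {n} {t} run≡ (length x) x [] refl (Fin.toℕ-fromℕ< _) (≡.sym (++-identityʳ x))

  α₀ γ₀ : ℚ
  α₀ = proj₁ startPath
  γ₀ = proj₁ (proj₂ startPath)

  path₀ : ∀ i → toℕ i ≡ length x → Path (reading (load nothing)) i (checked (input [])) (beginning x) α₀ γ₀
  path₀ i i≡ = subst (λ i → Path (reading (load nothing)) i (checked (input [])) (beginning x) α₀ γ₀)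
    (Fin.toℕ-injective (trans (Fin.toℕ-fromℕ< _) (≡.sym i≡))) (proj₂ (proj₂ startPath))

  0<α₀ : 0ℚ < α₀
  0<α₀ = 0<α (proj₂ (proj₂ startPath))

  0≤γ₀ : 0ℚ ≤ γ₀
  0≤γ₀ = 0≤γ (proj₂ (proj₂ startPath))

  α₀≤1 : α₀ ≤ 1ℚ
  α₀≤1 = α≤‖v‖² (proj₂ (proj₂ startPath))

  -- N exceeds the number of steps to the right end of the input, and H is chosen
  -- so that α₀ H - γ₀ = N.
  N : ℚ
  N = fromℕ (suc (suc (length x)))

  0≤N : 0ℚ ≤ N
  0≤N = 0≤fromℕ (suc (suc (length x)))

  abstract
    H : ℚ
    H = (1/ α₀) {{>-nonZero 0<α₀}} * (N + γ₀)

    0≤H : 0ℚ ≤ H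
    0≤H = 0≤-* (<⇒≤ (positive⁻¹ ((1/ α₀) {{>-nonZero 0<α₀}}) {{1/pos⇒pos α₀ {{positive 0<α₀}}}})) (0≤-+ 0≤N 0≤γ₀)

    α₀H≡N+γ₀ : α₀ * H ≡ N + γ₀
    α₀H≡N+γ₀ = trans (≡.sym (*-assoc α₀ ((1/ α₀) {{>-nonZero 0<α₀}}) (N + γ₀)))
      (trans (cong (_* (N + γ₀)) (*-inverseʳ α₀ {{>-nonZero 0<α₀}})) (*-identityˡ (N + γ₀)))

  -- By the renewal equation, H - N is γ₀ + (1 - α₀) H: the time from the right end of the input on,
  -- which is a sum of nonnegative terms.
  0≤H-N : 0ℚ ≤ H - N
  0≤H-N = subst (0ℚ ≤_) eq (0≤-+ (0≤-* (0≤-diff α₀≤1) 0≤H) 0≤γ₀)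
    where
    open ≡-Reasoning
    expand : ∀ a h c → (1ℚ - a) * h + c ≡ h - (a * h - c)
    expand = solve-∀ ℚ-ring
    cancel : ∀ a c → (a + c) - c ≡ a
    cancel = solve-∀ ℚ-ring
    eq : (1ℚ - α₀) * H + γ₀ ≡ H - N
    eq = begin
      (1ℚ - α₀) * H + γ₀      ≡⟨ expand α₀ H γ₀ ⟩
      H - (α₀ * H - γ₀)       ≡⟨ cong (λ y → H - (y - γ₀)) α₀H≡N+γ₀ ⟩
      H - ((N + γ₀) - γ₀)     ≡⟨ cong (λ y → H - y) (cancel N γ₀) ⟩
      H - N                   ∎

  -- With p the probability and μ = `weight b * (s * s)`, the value of `underway` is H (p - α μ) + γ
  -- μ: all weight but the succeeding α μ will at some point start anew at cost H, and γ μ is spent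
  -- on the path. At the right end the value of `seeking` is that of a fresh path plus one step, and
  -- each further cell adds one more.
  data Live (b : Branch) (w : ℚ) : Set where
    seeking   : state b ≡ reading seek → ∀ r → toℕ (position b) ℕ.+ r ≡ suc (length x) → 0ℚ ≤ weight b →
                ((H - N) + fromℕ (suc r)) * probability b ≤ w → Live b w
    underway  : ∀ {q v s α γ} → state b ≡ q → Path q (position b) v (progress x (history b)) α γ → Scaled b s v →
                0ℚ ≤ weight b → H * probability b - (α * H - γ) * (weight b * (s * s)) ≤ w → Live b w
    succeeded : ∀ {a} → state b ≡ accepting a → 0ℚ ≤ weight b → 0ℚ ≤ w → Live b w
    failed    : ∀ {a} → state b ≡ rejecting a → 0ℚ ≤ weight b → probability b ≡ 0ℚ → 0ℚ ≤ w → Live b w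

  live-weight : ∀ {b w} → Live b w → 0ℚ ≤ weight b
  live-weight (seeking _ _ _ 0≤w _)    = 0≤w
  live-weight (underway _ _ _ 0≤w _)   = 0≤w
  live-weight (succeeded _ 0≤w _)      = 0≤w
  live-weight (failed _ 0≤w _ _)       = 0≤w

  live-value : ∀ {b w} → Live b w → 0ℚ ≤ w
  live-value {b} (seeking _ r _ 0≤w ≤v) =
    ≤-trans (0≤-* (0≤-+ 0≤H-N (0≤fromℕ (suc r))) (0≤-probability b 0≤w)) ≤v
  live-value {b} (underway {v = v} {s} {α} {γ} _ path sc 0≤w ≤v) = ≤-trans (subst (0ℚ ≤_) eq nonneg) ≤v
    where
    μ : ℚ
    μ = weight b * (s * s)
    nonneg : 0ℚ ≤ μ * (H * (‖ v ‖² - α) + γ)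
    nonneg = 0≤-* (0≤-* 0≤w (0≤-square s)) (0≤-+ (0≤-* 0≤H (0≤-diff (α≤‖v‖² path))) (0≤γ path))
    expand : ∀ μ h n a c → μ * (h * (n - a) + c) ≡ h * (μ * n) - (a * h - c) * μ
    expand = solve-∀ ℚ-ring
    eq : μ * (H * (‖ v ‖² - α) + γ) ≡ H * probability b - (α * H - γ) * μ
    eq = trans (expand μ H ‖ v ‖² α γ) (cong (λ p → H * p - (α * H - γ) * μ) (≡.sym (scaled-probability b sc)))
  live-value (succeeded _ _ 0≤v)       = 0≤v
  live-value (failed _ _ _ 0≤v)        = 0≤v

  -- A failure may leave the input head anywhere. From the left end the search takes N steps in this
  -- count, the most possible, so H covers every position.
  idle : ∀ {b} → state b ≡ reading seek → 0ℚ ≤ weight b → Live b (H * probability b)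
  idle {b} eq 0≤w = seeking eq distance distance≡ 0≤w (≤-from-diff (0≤-* (0≤-diff distance≤N) (0≤-probability b 0≤w))
    (collect H N (fromℕ (suc distance)) (probability b)))
    where
    within : toℕ (position b) ℕ.≤ suc (length x)
    within = ℕ.≤-pred (subst (toℕ (position b) ℕ.<_) (length-delimit x) (Fin.toℕ<n (position b)))
    distance : ℕ
    distance = suc (length x) ℕ.∸ toℕ (position b)
    distance≡ : toℕ (position b) ℕ.+ distance ≡ suc (length x)
    distance≡ = ℕ.m+[n∸m]≡n within
    distance≤N : fromℕ (suc distance) ≤ N
    distance≤N = fromℕ-mono-≤ (s≤s (ℕ.m∸n≤m (suc (length x)) (toℕ (position b))))
    collect : ∀ h n f p → ((h - n) + f) * p + (n - f) * p ≡ h * p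
    collect = solve-∀ ℚ-ring

  open Splitting Live H idle

  Advances : Branch → ℚ → Set
  Advances b w = ∃[ ψ ] (Split Live (step b) ψ × ψ + probability b ≤ w)

  advances-by : ∀ b {bs w} → step b ≡ bs → ∃[ ψ ] (Split Live bs ψ × ψ + probability b ≤ w) → Advances b w
  advances-by b refl d = d

  relax : ∀ {b v w} → v ≤ w → Advances b v → Advances b w
  relax v≤w (ψ , split , ≤v) = ψ , split , ≤-trans ≤v v≤w

  seeking-advances : ∀ b → state b ≡ reading seek → ∀ r → toℕ (position b) ℕ.+ r ≡ suc (length x) →
    0ℚ ≤ weight b → Advances b (((H - N) + fromℕ (suc r)) * probability b)
  seeking-advances b eq zero r≡ 0≤w =
    advances-by b (step-action b eq (cong (action seek) (lookup-⊣ x (position b) at-end)))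
      (_ , underway {b = b′} {s = 1ℚ} refl (path₀ _ at-start) (scaled λ { 0F → refl ; 1F → refl ; 2F → refl ; 3F → refl })
             (0≤-probability b 0≤w) ≤-refl ∷ []
         , ≤-reflexive (begin
             ((H * probability b′ - (α₀ * H - γ₀) * (probability b * (1ℚ * 1ℚ))) + 0ℚ) + probability b
               ≡⟨ cong₂ (λ p y → ((H * p - (y - γ₀) * (probability b * (1ℚ * 1ℚ))) + 0ℚ) + probability b)
                    (restarted-probability (reading (load nothing)) left b) α₀H≡N+γ₀ ⟩
             ((H * probability b - ((N + γ₀) - γ₀) * (probability b * (1ℚ * 1ℚ))) + 0ℚ) + probability b
               ≡⟨ collect H (probability b) N γ₀ ⟩
             ((H - N) + (1ℚ + 0ℚ)) * probability b ∎))
    where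
    open ≡-Reasoning
    b′ : Branch
    b′ = restarted-at (reading (load nothing)) left b
    at-end : toℕ (position b) ≡ suc (length x)
    at-end = trans (≡.sym (ℕ.+-identityʳ _)) r≡
    at-start : toℕ (Fin.pred (position b)) ≡ length x
    at-start = trans (toℕ-pred (position b)) (cong ℕ.pred at-end)
    collect : ∀ h p n c → ((h * p - ((n + c) - c) * (p * (1ℚ * 1ℚ))) + 0ℚ) + p ≡ ((h - n) + (1ℚ + 0ℚ)) * p
    collect = solve-∀ ℚ-ring
  seeking-advances b eq (suc r) r≡ 0≤w =
    advances-by b (step-action b eq (not-⊣ (symbol b) refl))
      (_ , seeking {b = b′} refl r r≡′ (0≤-probability b 0≤w) ≤-refl ∷ []
         , ≤-reflexive (trans
             (cong (λ p → (((H - N) + fromℕ (suc r)) * p + 0ℚ) + probability b)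
               (restarted-probability (reading seek) right b))
             (collect H N (fromℕ (suc r)) (probability b))))
    where
    b′ : Branch
    b′ = restarted-at (reading seek) right b
    below : suc (toℕ (position b)) ℕ.≤ suc (length x)
    below = subst (suc (toℕ (position b)) ℕ.≤_) (trans (≡.sym (ℕ.+-suc _ r)) r≡) (ℕ.m≤m+n _ r)
    r≡′ : toℕ (forward (position b)) ℕ.+ r ≡ suc (length x)
    r≡′ = trans (cong (ℕ._+ r) (toℕ-forward (position b)
            (subst (suc (toℕ (position b)) ℕ.<_) (≡.sym (length-delimit x)) (s≤s below))))
          (trans (≡.sym (ℕ.+-suc _ r)) r≡)
    not-⊣ : ∀ a → symbol b ≡ a → action seek a ≡ restart (reading seek) right
    not-⊣ ⊢       _  = refl
    not-⊣ (sym a) _  = refl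
    not-⊣ ⊣       b⊣ = contradiction below (ℕ.<⇒≱ (s≤s (ℕ.≤-reflexive (≡.sym (⊣-position x (position b) b⊣)))))
    collect : ∀ h n f p → (((h - n) + f) * p + 0ℚ) + p ≡ ((h - n) + (1ℚ + f)) * p
    collect = solve-∀ ℚ-ring

  underway-advances : ∀ b {q v s α γ} → state b ≡ q → Path q (position b) v (progress x (history b)) α γ →
    Scaled b s v → 0ℚ ≤ weight b → Advances b (H * probability b - (α * H - γ) * (weight b * (s * s)))
  underway-advances b {v = v} {s} eq (measured v₀≡1) sc@(scaled reg≡) 0≤w =
    advances-by b (step-action b eq refl)
      (_ , conclude-split b 0≤w (succeeded refl 0≤w ≤-refl)
         , ≤-reflexive (begin
             (0ℚ + H * (probability b - probability (concluded b 0F))) + probability b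
               ≡⟨ cong₂ (λ p₀ p → (0ℚ + H * (probability b - p₀)) + p) p₀≡μ (scaled-probability b sc) ⟩
             (0ℚ + H * (probability b - μ)) + μ * ‖ v ‖²
               ≡⟨ collect H (probability b) μ ‖ v ‖² ⟩
             H * probability b - (1ℚ * H - ‖ v ‖²) * μ ∎))
    where
    open ≡-Reasoning
    μ : ℚ
    μ = weight b * (s * s)
    p₀≡μ : probability (concluded b 0F) ≡ μ
    p₀≡μ = trans (concluded-probability b)
      (cong (λ y → weight b * (y * y)) (trans (reg≡ 0F) (trans (cong (s *_) v₀≡1) (*-identityʳ s))))
    collect : ∀ h p μ n → (0ℚ + h * (p - μ)) + μ * n ≡ h * p - (1ℚ * h - n) * μ
    collect = solve-∀ ℚ-ring
  underway-advances b {v = v} {s} eq (gating {R = R} {q′} {m} {α = α} {γ} act Rv≗v′ path) sc 0≤w =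
    advances-by b (step-action b eq act)
      (_ , gate-split R q′ m b 0≤w (underway {b = b′} refl path (gated-scaled q′ m b sc Rv≗v′) 0≤w ≤-refl)
         , ≤-reflexive (trans
             (cong (value + H * (probability b - probability b′) +_) (scaled-probability b sc))
             (collect H (probability b′) (probability b) α γ (weight b) κ s ‖ v ‖²)))
    where
    b′ : Branch
    b′ = gated R q′ m b 1F
    κ value : ℚ
    κ = Gate.scale (keeping R)
    value = H * probability b′ - (α * H - γ) * (weight b * ((κ * s) * (κ * s)))
    collect : ∀ h p′ p a c w κ s n →
      ((h * p′ - (a * h - c) * (w * ((κ * s) * (κ * s)))) + h * (p - p′)) + (w * (s * s)) * n ≡
      h * p - (((κ * κ) * a) * h - (n + (κ * κ) * c)) * (w * (s * s))
    collect = solve-∀ ℚ-ring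
  underway-advances b {s = s} eq (discarding {q′ = q′} {l} {r} {α} {γ} act path) sc@(scaled reg≡) 0≤w =
    advances-by b (step-action b eq act)
      (_ , underway {b = b′} refl path (discarded-scaled q′ b sc) 0≤w ≤-refl
             ∷ failed {b = fail} refl 0≤w fail≡0 ≤-refl ∷ []
         , ≤-reflexive (begin
             ((H * probability b′ - (α * H - γ) * μ) + (0ℚ + 0ℚ)) + probability b
               ≡⟨ cong₂ (λ p′ p → ((H * p′ - (α * H - γ) * μ) + (0ℚ + 0ℚ)) + p) kept (scaled-probability b sc) ⟩
             ((H * probability b - (α * H - γ) * μ) + (0ℚ + 0ℚ)) + μ * n′
               ≡⟨ collect H (probability b) α γ μ n′ ⟩
             H * probability b - (α * H - (n′ + γ)) * μ ∎))
    where
    open ≡-Reasoning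
    b′ fail : Branch
    b′   = discarded q′ b 0F
    fail = discarded q′ b 1F
    μ n′ : ℚ
    μ  = weight b * (s * s)
    n′ = ‖ ⟨ 1ℚ , 0ℚ , l , r ⟩ ‖²
    -- Rejecting branches do occur in the honest interaction, but only with probability zero, so
    -- they owe nothing for the steps spent there.
    fail≡0 : probability fail ≡ 0ℚ
    fail≡0 = trans (discarded-probability q′ b)
      (trans (cong (λ y → weight b * (y * y)) (trans (reg≡ 1F) (*-zeroʳ s))) (*-zeroʳ (weight b)))
    kept : probability b′ ≡ probability b
    kept = trans (≡.sym (+-identityʳ _)) (trans (cong (probability b′ +_) (≡.sym fail≡0)) (discard-probability q′ b))
    collect : ∀ h p a c μ n → ((h * p - (a * h - c) * μ) + (0ℚ + 0ℚ)) + μ * n ≡ h * p - (a * h - (n + c)) * μ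
    collect = solve-∀ ℚ-ring
  underway-advances b {v = v} {s} eq (asked {s = pending} {α = α} {γ} refl refl path) sc 0≤w =
    advances-by b (cong (λ q → stepFrom q b) eq)
      (_ , underway {b = communicate pending b} {s = s} refl path′ (scaled (Scaled.components sc)) 0≤w ≤-refl ∷ []
         , ≤-reflexive (trans
             (cong (((H * probability b - (α * H - γ) * μ) + 0ℚ) +_) (scaled-probability b sc))
             (collect H (probability b) α γ μ ‖ v ‖²)))
    where
    g : Progress
    g = progress x (history b)
    μ : ℚ
    μ = weight b * (s * s)
    path′ : Path (Verifier.answer V pending (reply g)) (position b) v (progress x (reply g ∷ query ∷ history b)) α γ
    path′ = subst (λ g′ → Path (Verifier.answer V pending (reply g)) (position b) v g′ α γ)
      (≡.sym (progress-reply x (query ∷ history b) g)) path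
    collect : ∀ h p a c μ n → ((h * p - (a * h - c) * μ) + 0ℚ) + μ * n ≡ h * p - (a * h - (n + c)) * μ
    collect = solve-∀ ℚ-ring

  descends : ∀ {b w} → Live b w → (∃[ a ] state b ≡ accepting a) ⊎ Advances b w
  descends {b} (seeking eq r r≡ 0≤w ≤v)    = inj₂ (relax {b} ≤v (seeking-advances b eq r r≡ 0≤w))
  descends {b} (underway eq path sc 0≤w ≤v) = inj₂ (relax {b} ≤v (underway-advances b eq path sc 0≤w))
  descends (succeeded eq _ _)              = inj₁ (_ , eq)
  descends {b} {w} (failed eq 0≤w p≡0 0≤v) = inj₂ (advances-by b (cong (λ q → stepFrom q b) eq)
    (w + 0ℚ , failed eq 0≤w p≡0 0≤v ∷ [] ,
     ≤-reflexive (trans (cong₂ _+_ (+-identityʳ w) p≡0) (+-identityʳ w))))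

  deficit-bound : ∀ k → fromℕ k * (1ℚ - acceptedWithin k) ≤ H * 1ℚ
  deficit-bound k = Drift.deficit≤ Live live-weight live-value descends k (idle {b = initially} refl 0≤1)

-- Convergence from a bound on the expected time

fromℕ-mkℚ : ∀ n → fromℕ n ≡ mkℚ (ℤ.+ n) 0 (Coprimality.sym (Coprimality.1-coprimeTo n))
fromℕ-mkℚ zero    = refl
fromℕ-mkℚ (suc n) = begin
  1ℚ + fromℕ n
    ≡⟨ cong (1ℚ +_) (fromℕ-mkℚ n) ⟩
  (ℤ.+ 1 ℤ.* ℤ.+ 1 ℤ.+ ℤ.+ n ℤ.* ℤ.+ 1) / 1
    ≡⟨ cong (λ i → (ℤ.+ 1 ℤ.+ i) / 1) (ℤ.*-identityʳ (ℤ.+ n)) ⟩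
  ℤ.+ suc n / 1
    ≡⟨ normalize-coprime (Coprimality.sym (Coprimality.1-coprimeTo (suc n))) ⟩
  mkℚ (ℤ.+ suc n) 0 _ ∎
  where open ≡-Reasoning

archimedean : ∀ p → ∃[ n ] p < fromℕ n
archimedean p@(mkℚ i d _) = suc ℤ.∣ i ∣ , subst (p <_) (≡.sym (fromℕ-mkℚ (suc ℤ.∣ i ∣))) (*<* (begin-strict
  i ℤ.* ℤ.+ 1                        ≡⟨ ℤ.*-identityʳ i ⟩
  i                                  ≤⟨ i≤∣i∣ i ⟩
  ℤ.+ ℤ.∣ i ∣                        <⟨ ℤ.+<+ (ℕ.n<1+n ℤ.∣ i ∣) ⟩
  ℤ.+ suc ℤ.∣ i ∣                    ≤⟨ ℤ.+≤+ (ℕ.m≤m*n (suc ℤ.∣ i ∣) (suc d)) ⟩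
  ℤ.+ (suc ℤ.∣ i ∣ ℕ.* suc d)        ≡⟨ ℤ.pos-* (suc ℤ.∣ i ∣) (suc d) ⟩
  ℤ.+ suc ℤ.∣ i ∣ ℤ.* ℤ.+ suc d      ∎))
  where
  open ℤ.≤-Reasoning
  i≤∣i∣ : ∀ i → i ℤ.≤ ℤ.+ ℤ.∣ i ∣
  i≤∣i∣ (ℤ.+ n)      = ℤ.≤-refl
  i≤∣i∣ ℤ.-[1+ n ]   = ℤ.-≤+

vanishing : ∀ c {g : ℕ → ℚ} → (∀ n → fromℕ n * (1ℚ - g n) ≤ c) → ∀ δ → 0ℚ < δ → ∃[ k ] 1ℚ - δ < g k
vanishing c {g} bound δ 0<δ = k , (begin-strict
  1ℚ - δ                   <⟨ +-monoʳ-< 1ℚ (neg-antimono-< deficit<δ) ⟩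
  1ℚ - (1ℚ - g k)          ≡⟨ cancel (g k) ⟩
  g k                      ∎)
  where
  open ≤-Reasoning
  1/δ : ℚ
  1/δ = (1/ δ) {{>-nonZero 0<δ}}
  k : ℕ
  k = proj₁ (archimedean (c * 1/δ))
  c<kδ : c < fromℕ k * δ
  c<kδ = begin-strict
    c                 ≡⟨ *-identityʳ c ⟨
    c * 1ℚ            ≡⟨ cong (c *_) (*-inverseˡ δ {{>-nonZero 0<δ}}) ⟨
    c * (1/δ * δ)     ≡⟨ *-assoc c 1/δ δ ⟨
    (c * 1/δ) * δ     <⟨ *-monoˡ-<-pos δ {{positive 0<δ}} (proj₂ (archimedean (c * 1/δ))) ⟩
    fromℕ k * δ       ∎
  deficit<δ : 1ℚ - g k < δ
  -- The strict inequality already rules out k = 0, so a nonnegative factor can be cancelled.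
  deficit<δ = *-cancelˡ-<-nonNeg (fromℕ k) {{nonNegative (0≤fromℕ k)}} (≤-<-trans (bound k) c<kδ)
  cancel : ∀ x → 1ℚ - (1ℚ - x) ≡ x
  cancel = solve-∀ ℚ-ring

-- Constant space and the conclusion

module _ {A : Set} (A-finite : Finite A) (M : TuringMachine A) where
  open Protocol A-finite M

  -- Every transition writes a blank and leaves the work head in place, so the work tape remains a
  -- single blank cell.
  constant-space : SpaceBounded (λ _ → 1) V
  constant-space = 1 , λ P x n → let open Branches P x in
    All.map (λ blank _ → ℕ.≤-reflexive (cong cells blank)) (run-All (untouched P x) n _ refl)
    where
    untouched : ∀ P x → let open Branches P x in
                ∀ b → work b ≡ blankTape → All (λ b′ → work b′ ≡ blankTape) (step b)
    untouched P x b blank = lemma (state b)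
      where
      open Branches P x
      unwritten : move stay (write nothing (work b)) ≡ blankTape
      unwritten = cong (write nothing) blank
      performed : ∀ a → All (λ b′ → work b′ ≡ blankTape) (perform (operate a) b)
      performed (restart _ _) = unwritten ∷ []
      performed (gate _ _ _)  = unwritten ∷ unwritten ∷ unwritten ∷ unwritten ∷ unwritten ∷ []
      performed (discard _)   = unwritten ∷ unwritten ∷ []
      performed conclude      = unwritten ∷ unwritten ∷ []
      lemma : ∀ q → All (λ b′ → work b′ ≡ blankTape) (stepFrom q b)
      lemma (reading q)       = performed (action q (symbol b))
      lemma (communicating s) = blank ∷ []
      lemma (accepting _)     = blank ∷ []
      lemma (rejecting _)     = blank ∷ []

  completeness : ∀ x → M.Accepts x → Interaction.AcceptsWithProbability V (HonestProver.P A-finite M) x 1ℚ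
  completeness x (n , t , run≡) =
      (λ k → gain≤probability k initially 0≤1)
    , vanishing (H * 1ℚ) deficit-bound
    where
    open Branches (HonestProver.P A-finite M) x
    open Recurrence A-finite M x {n} {t} run≡

theorem2 : ∀ {ℓ : Level} {A : Set} → Finite A → (L : Language A ℓ) →
    TuringRecognizable L → L ∈ weak-qAM₁ (λ _ → 1)
theorem2 A-finite L (M , L⇔M) =
    Simulation.V A-finite M
  , HonestProver.P A-finite M
  , ¼
  , constant-space A-finite M
  , toWitness {a? = ¼ <? ½} _
  , (λ x Lx → completeness A-finite M x (Equivalence.to (L⇔M x) Lx))
  , (λ x ¬Lx P* → Soundness.soundness A-finite M P* x (λ accepts → ¬Lx (Equivalence.from (L⇔M x) accepts)))
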